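{- Assume the strong set disjointness conjecture for some large enough $T=N_F^{o(1)}$. For $n$-vertex $m$-edge graphs where $m=\Theta(n)$, there is no fully dynamic sensitivity oracle for subgraph connectivity with space $O(n^{2-\epsilon})$ and update time and query time of the form $f(d)\cdot n^{o(1)}$ (for a function $f$), for any constant $\epsilon>0$.
   Context: Fully dynamic sensitivity oracle problem for subgraph connectivity. Preprocessing phase: given an integer $d_{\star}$ and an undirected graph $G=(V,E)$ with $n$ vertices and $m$ edges, whose vertex set is partitioned into activated vertices $V_{\mathrm{on}}$ and deactivated vertices $V_{\mathrm{off}}$, build a data structure. Update phase: a single set $D\subseteq V$ with $|D|=d\le d_{\star}$ is received, representing the vertices whose states are switched; let $V_{\mathrm{new}}=(V_{\mathrm{on}}\setminus D)\cup(V_{\mathrm{off}}\cap D)$. Query phase: each query gives $u,v\in V_{\mathrm{new}}$ and must be answered by whether $u$ and $v$ are connected in $G[V_{\mathrm{new}}]$. Update time and (per-)query time are the times taken in the corresponding phases; space is the space of the data structure stored after preprocessing. When discussing lower bounds, $d=d_{\star}$ is assumed for each update. Set disjointness problem: preprocess a family $F$ of sets, all from a universe $U$, of total size $N_F=\sum_{S\in F}|S|$, so that given two query sets $S,S'\in F$ one can determine whether $S\cap S'=\emptyset$. Strong set disjointness conjecture (for a query time bound $T$): any data structure for the set disjointness problem that answers queries in $T$ time must use $\widetilde{\Omega}(N_F^{2}/T^{2})$ space, where $\widetilde{\Omega}$ hides polylogarithmic factors. -}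

module Defs where

open import Data.Bool using (Bool; true; false; if_then_else_; _∧_; _∨_; _xor_)
open import Data.Fin as Fin using (Fin; toℕ)
open import Data.Fin.Subset using (Subset; ∣_∣; _∩_; _∪_; _─_; ∁; Empty; _∈_)
open import Data.Integer using () renaming (∣_∣ to abs)
open import Data.List using (List; []; _∷_; length; map; allFin)
open import Data.List.Membership.Propositional using () renaming (_∈_ to _∈ₗ_)
open import Data.List.Relation.Unary.All using (All)
open import Data.List.Relation.Unary.Unique.Propositional using (Unique)
open import Data.Nat
open import Data.Nat.DivMod using (_mod_)
open import Data.Nat.ListAction using (sum)
open import Data.Nat.Logarithm using (⌊log₂_⌋)
open import Data.Nat.Properties using (m^n≢0)
open import Data.Product using (_×_; _,_; proj₁; proj₂; ∃; ∃-syntax)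
open import Data.Rational using (ℚ; ↥_; ↧ₙ_)
open import Data.Sum using (_⊎_)
open import Function.Bundles using (_⇔_)
open import Function.Definitions using (Injective)
open import Relation.Binary.Construct.Closure.ReflexiveTransitive using (Star)
open import Relation.Binary.PropositionalEquality using (_≡_; _≢_)
open import Relation.Nullary using (¬_)

------------------------------------------------------------------------
-- Asymptotics

Eventually : (ℕ → Set) → Set
Eventually P = ∃[ N₀ ] ∀ N → N₀ ≤ N → P N

-- g(N) = N^{o(1)}: for every constant k ≥ 1, g(N) ≤ N^{1/k} for large N.
Subpolynomial : (ℕ → ℕ) → Set
Subpolynomial g = ∀ k → 1 ≤ k → Eventually λ N → g N ^ k ≤ N

-- μ(n) = Θ(n)
LinearΘ : (ℕ → ℕ) → Set
LinearΘ μ = ∃[ a ] ∃[ b ] Eventually λ n → (n ≤ a * μ n) × (μ n ≤ b * n)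

-- s(n) = O(n^{2-ε}).  With ε = p/q, the inequality s ≤ c · n^{2-p/q} is
-- raised to the power q and multiplied by n^p; the constant c^q is C.
O[n^2-_] : ℚ → (ℕ → ℕ) → Set
O[n^2- ε ] s =
  ∃[ C ] Eventually λ n → s n ^ ↧ₙ ε * n ^ abs (↥ ε) ≤ C * n ^ (2 * ↧ₙ ε)

-- s(N) = Ω̃(N²/T(N)²): s(N) ≥ N² / (C · T(N)² · polylog N) for large N.
Ω̃[N²/_²] : (ℕ → ℕ) → (ℕ → ℕ) → Set
Ω̃[N²/ T ²] s =
  ∃[ C ] ∃[ k ] Eventually λ N →
    N ^ 2 ≤ C * (1 + ⌊log₂ N ⌋) ^ k * T N ^ 2 * s N

------------------------------------------------------------------------
-- Word RAM with w-bit words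
--
-- Programs are in structured form.  This agrees with jump-based RAM code up
-- to constant factors, since a program counter can be kept in a register.

record Word (w : ℕ) : Set where
  constructor word
  field
    fin : Fin (2 ^ w)

val : ∀ {w} → Word w → ℕ
val x = toℕ (Word.fin x)

wrap : ∀ {w} → ℕ → Word w
wrap {w} x = word (_mod_ x (2 ^ w) {{m^n≢0 2 w}})

Memory : ℕ → Set
Memory w = Word w → Word w

fill : ∀ {w} → List (Word w) → Memory w
fill {w} xs a = go xs (val a)
  where
  go : List (Word w) → ℕ → Word w
  go []       _       = wrap 0
  go (x ∷ _)  zero    = x
  go (_ ∷ xs) (suc i) = go xs i

zeros : ∀ {w} → Memory w
zeros = fill []

data Op : Set where
  add sub mul div mod and or xor shl shr eq lt : Op

fromBool : Bool → ℕ
fromBool b = if b then 1 else 0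

bitwise : (Bool → Bool → Bool) → ℕ → ℕ → ℕ → ℕ
bitwise f zero    x y = 0
bitwise f (suc w) x y =
  fromBool (f (x % 2 ≡ᵇ 1) (y % 2 ≡ᵇ 1)) + 2 * bitwise f w (x / 2) (y / 2)

-- Values are reduced modulo 2^w afterwards; div and mod by zero return 0.
evalℕ : ℕ → Op → ℕ → ℕ → ℕ
evalℕ w add x y       = x + y
evalℕ w sub x y       = x + (2 ^ w ∸ y)
evalℕ w mul x y       = x * y
evalℕ w div x zero    = 0
evalℕ w div x (suc y) = x / suc y
evalℕ w mod x zero    = 0
evalℕ w mod x (suc y) = x % suc y
evalℕ w and x y       = bitwise _∧_ w x y
evalℕ w or  x y       = bitwise _∨_ w x y
evalℕ w xor x y       = bitwise _xor_ w x y
evalℕ w shl x y       = x * 2 ^ y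
evalℕ w shr x y       = _/_ x (2 ^ y) {{m^n≢0 2 y}}
evalℕ w eq  x y       = fromBool (x ≡ᵇ y)
evalℕ w lt  x y       = fromBool (x <ᵇ y)

eval : ∀ {w} → Op → Word w → Word w → Word w
eval {w} o x y = wrap (evalℕ w o (val x) (val y))

-- Two randomly accessible memories, both readable and writable: `store`
-- initially holds the data structure, `args` initially holds array inputs.
data Segment : Set where
  store args : Segment

Reg : Set
Reg = ℕ

infixr 5 _⨾_

data Prog : Set where
  skip   : Prog
  _⨾_    : Prog → Prog → Prog
  set    : Reg → ℕ → Prog
  op     : Op → Reg → Reg → Reg → Prog       -- op o r a b : r := a o b
  load   : Segment → Reg → Reg → Prog        -- load g r a : r := g[a]
  save   : Segment → Reg → Reg → Prog        -- save g a r : g[a] := r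
  ifnz   : Reg → Prog → Prog → Prog
  while  : Reg → Prog → Prog

record State (w : ℕ) : Set where
  constructor state
  field
    reg    : Reg → Word w
    dataᵐ  : Memory w
    argsᵐ  : Memory w

open State public

mem : ∀ {w} → Segment → State w → Memory w
mem store = dataᵐ
mem args  = argsᵐ

_[_≔_] : ∀ {w} → State w → Reg → Word w → State w
σ [ r ≔ x ] = record σ { reg = λ r′ → if r′ ≡ᵇ r then x else reg σ r′ }

updᵐ : ∀ {w} → Memory w → Word w → Word w → Memory w
updᵐ m a x a′ = if val a′ ≡ᵇ val a then x else m a′

write : ∀ {w} → Segment → Word w → Word w → State w → State w
write store a x σ = record σ { dataᵐ = updᵐ (dataᵐ σ) a x }
write args  a x σ = record σ { argsᵐ = updᵐ (argsᵐ σ) a x }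

-- p ∶ σ ⇓[ t ] σ′ : run from σ, the program p halts in σ′ after t unit-cost
-- steps.
infix 4 _∶_⇓[_]_

data _∶_⇓[_]_ {w : ℕ} : Prog → State w → ℕ → State w → Set where
  skip⇓ : ∀ {σ} → skip ∶ σ ⇓[ 0 ] σ
  seq⇓  : ∀ {p q σ σ′ σ″ t t′} →
          p ∶ σ ⇓[ t ] σ′ → q ∶ σ′ ⇓[ t′ ] σ″ → p ⨾ q ∶ σ ⇓[ t + t′ ] σ″
  set⇓  : ∀ {r c σ} → set r c ∶ σ ⇓[ 1 ] (σ [ r ≔ wrap c ])
  op⇓   : ∀ {o r a b σ} →
          op o r a b ∶ σ ⇓[ 1 ] (σ [ r ≔ eval o (reg σ a) (reg σ b) ])
  load⇓ : ∀ {g r a σ} → load g r a ∶ σ ⇓[ 1 ] (σ [ r ≔ mem g σ (reg σ a) ])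
  save⇓ : ∀ {g a r σ} → save g a r ∶ σ ⇓[ 1 ] write g (reg σ a) (reg σ r) σ
  if⇓   : ∀ {r p q σ σ′ t} → val (reg σ r) ≢ 0 →
          p ∶ σ ⇓[ t ] σ′ → ifnz r p q ∶ σ ⇓[ suc t ] σ′
  else⇓ : ∀ {r p q σ σ′ t} → val (reg σ r) ≡ 0 →
          q ∶ σ ⇓[ t ] σ′ → ifnz r p q ∶ σ ⇓[ suc t ] σ′
  loop⇓ : ∀ {r p σ σ′ σ″ t t′} → val (reg σ r) ≢ 0 →
          p ∶ σ ⇓[ t ] σ′ → while r p ∶ σ′ ⇓[ t′ ] σ″ →
          while r p ∶ σ ⇓[ suc (t + t′) ] σ″
  done⇓ : ∀ {r p σ} → val (reg σ r) ≡ 0 → while r p ∶ σ ⇓[ 1 ] σ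

initial : ∀ {w} → Memory w → Memory w → State w
initial d a = state (λ _ → wrap 0) d a

-- The two scalar arguments of a query are passed in registers 0 and 1.
withQuery : ∀ {w} → ℕ → ℕ → State w → State w
withQuery x y σ = (σ [ 0 ≔ wrap x ]) [ 1 ≔ wrap y ]

-- p halts within t steps from σ in some state satisfying Q.
Within : ∀ {w} → ℕ → Prog → State w → (State w → Set) → Set
Within t p σ Q = ∃[ t′ ] ∃[ σ′ ] (p ∶ σ ⇓[ t′ ] σ′) × t′ ≤ t × Q σ′

-- Register 0 holds the truth value of P.
Decides : ∀ {w} → Set → State w → Set
Decides P σ = (val (reg σ 0) ≡ 1 × P) ⊎ (val (reg σ 0) ≡ 0 × ¬ P)

-- w(n) = Θ(log n), and at least the number of bits of n.
WordLength : (ℕ → ℕ) → Set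
WordLength w =
  (∀ n → 1 + ⌊log₂ n ⌋ ≤ w n) × (∃[ c ] ∀ n → w n ≤ c * (1 + ⌊log₂ n ⌋))

-- The data structure occupies the first s words of a zero-initialised memory.
Occupies : ∀ {w} → Memory w → ℕ → Set
Occupies m s = ∀ a → s ≤ val a → val (m a) ≡ 0

------------------------------------------------------------------------
-- Set disjointness

-- A set of subsets of the universe Fin universe.  Queries refer to a member
-- by its index.
record Family : Set where
  field
    universe : ℕ
    count    : ℕ
    sets     : Fin count → Subset universe
    distinct : Injective _≡_ _≡_ sets

  total : ℕ
  total = sum (map (λ i → ∣ sets i ∣) (allFin count))

open Family public

-- Preprocessing is an arbitrary function, as its time is not restricted.
record DisjointnessStructure (T s : ℕ → ℕ) : Set where
  field
    w          : ℕ → ℕ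
    wordLength : WordLength w
    preprocess : (F : Family) → Memory (w (total F))
    query      : Prog
    space      : ∀ F → Occupies (preprocess F) (s (total F))
    correct    : ∀ F (i j : Fin (count F)) →
      Within (T (total F)) query
        (withQuery (toℕ i) (toℕ j) (initial (preprocess F) zeros))
        (Decides (Empty (sets F i ∩ sets F j)))

StrongSetDisjointness : (ℕ → ℕ) → Set
StrongSetDisjointness T =
  ∀ (s : ℕ → ℕ) → DisjointnessStructure T s → Ω̃[N²/ T ²] s

------------------------------------------------------------------------
-- Subgraph connectivity

-- Simple undirected graph; each edge {u, v} is listed once, with u < v.
record Graph (n : ℕ) : Set where
  field
    edges  : List (Fin n × Fin n)
    sorted : All (λ e → proj₁ e Fin.< proj₂ e) edges
    unique : Unique edges

  Adjacent : Fin n → Fin n → Set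
  Adjacent u v = ((u , v) ∈ₗ edges) ⊎ ((v , u) ∈ₗ edges)

open Graph public

ConnectedIn : ∀ {n} → Graph n → Subset n → Fin n → Fin n → Set
ConnectedIn G S = Star λ u v → Adjacent G u v × u ∈ S × v ∈ S

V-new : ∀ {n} → Subset n → Subset n → Subset n
V-new Vₒₙ D = (Vₒₙ ─ D) ∪ (∁ Vₒₙ ∩ D)

Lists : ∀ {n} → List (Fin n) → Subset n → Set
Lists xs D = Unique xs × (∀ v → v ∈ₗ xs ⇔ v ∈ D)

-- Oracles for n-vertex graphs with μ(n) edges, in the lower-bound setting
-- d = d⋆.  Here s bounds the space, and both the update time and the query
-- time are at most τ d n.  The update receives d in register 0 and the
-- elements of D, in any order, in the segment args; a query starts in the
-- machine state left by the update.
record ConnectivityOracle (μ : ℕ → ℕ) (τ : ℕ → ℕ → ℕ) (s : ℕ → ℕ) : Set where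
  field
    w             : ℕ → ℕ
    wordLength    : WordLength w
    preprocess    : ∀ (d : ℕ) {n} (G : Graph n) → length (edges G) ≡ μ n →
                    (Vₒₙ : Subset n) → Memory (w n)
    update query  : Prog
    space         : ∀ d {n} (G : Graph n) (m≡ : length (edges G) ≡ μ n) Vₒₙ →
                    Occupies (preprocess d G m≡ Vₒₙ) (s n)
    correct       :
      ∀ d {n} (G : Graph n) (m≡ : length (edges G) ≡ μ n) Vₒₙ (D : Subset n) →
      ∣ D ∣ ≡ d → ∀ xs → Lists xs D →
      Within (τ d n) update
        (initial (preprocess d G m≡ Vₒₙ) (fill (map (λ v → wrap (toℕ v)) xs))
          [ 0 ≔ wrap d ])
        λ σ → ∀ u v → u ∈ V-new Vₒₙ D → v ∈ V-new Vₒₙ D →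
          Within (τ d n) query (withQuery (toℕ u) (toℕ v) σ)
            (Decides (ConnectedIn G (V-new Vₒₙ D) u v))

{-# OPTIONS --safe #-}

-- A family of total size N becomes a graph on n = Θ(N) vertices in which every
-- set and every element is a vertex, adjacent if the element lies in the set.
-- The elements are active and the sets are not, so after switching on two sets,
-- an update of size d = 2, they are connected exactly if they intersect.  Hence
-- an oracle answers a disjointness query by an update and a connectivity query,
-- in time n^o(1) and space O(n^(2-ε)) = O(N^(2-ε)), below the conjectured bound.
module Submission where

open import Defs
open import Data.Bool using (Bool; true; false)
open import Data.Bool.Properties using (T-≡)
open import Data.Fin as Fin using (Fin; toℕ; fromℕ<)
open import Data.Fin.Properties using (toℕ-fromℕ<; toℕ-injective; toℕ<n)
open import Data.Fin.Subset using (Subset; ⊥; ⁅_⁆; ∣_∣; _∩_; _∪_; Empty; _∈_; _∉_)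
open import Data.Fin.Subset.Properties
  using (∣⁅x⁆∣≡1; ∪-identityˡ; ∪-identityʳ; Empty-unique; p─q⊆p; x∈p∧x∉q⇒x∈p─q; x∈p∪q⁺; x∈p∪q⁻;
         x∈p∩q⁺; x∈p∩q⁻; x∉p⇒x∈∁p; x∈⁅x⁆; x∈⁅y⁆⇒x≡y)
open import Data.Integer using (+[1+_]) renaming (∣_∣ to abs)
open import Data.List
  using (List; []; _∷_; _++_; length; map; concat; take; allFin; applyUpTo; cartesianProduct)
open import Data.List.Membership.Propositional using () renaming (_∈_ to _∈ₗ_)
open import Data.List.Membership.Propositional.Properties
  using (∈-map⁺; ∈-map⁻; ∈-++⁺ˡ; ∈-++⁺ʳ; ∈-++⁻; ∈-allFin; ∈-concat⁺′; ∈-concat⁻′;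
         ∈-cartesianProduct⁻; ∈-applyUpTo⁻)
open import Data.List.Properties
  using (length-map; length-++; length-take; length-applyUpTo; length-tabulate; map-cong)
open import Data.List.Relation.Unary.All as All using (All; []; _∷_)
import Data.List.Relation.Unary.All.Properties as All
open import Data.List.Relation.Unary.AllPairs as AllPairs using ([]; _∷_)
import Data.List.Relation.Unary.AllPairs.Properties as AllPairs
open import Data.List.Relation.Unary.Any using (here; there)
open import Data.List.Relation.Unary.Unique.Propositional using (Unique)
import Data.List.Relation.Unary.Unique.Propositional.Properties as Unique
open import Data.Nat
open import Data.Nat.DivMod
  using (m≡m%n+[m/n]*n; m%n<n; m/n*n≤m; m<n⇒m%n≡m; %-distribˡ-+)
open import Data.Nat.Induction using (<-rec)
open import Data.Nat.ListAction using (sum)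
open import Data.Nat.Logarithm
open import Data.Nat.Properties
open import Data.Nat.Tactic.RingSolver using (solve-∀)
open import Data.Product using (_×_; _,_; proj₁; proj₂; ∃-syntax)
open import Data.Product.Properties using (,-injectiveˡ; ,-injectiveʳ)
open import Data.Rational using (ℚ; mkℚ; Positive; ↥_; ↧ₙ_)
open import Data.Sum as Sum using (_⊎_; inj₁; inj₂)
open import Data.Vec using ([]; _∷_; tabulate; here; there)
open import Data.Vec.Properties using ([]=⇒lookup; lookup⇒[]=; lookup∘tabulate)
open import Function.Base using (_∘_)
open import Function.Bundles using (Equivalence; mk⇔)
open import Relation.Binary.Construct.Closure.ReflexiveTransitive using (ε; _◅_)
open import Relation.Binary.PropositionalEquality
open import Relation.Nullary
open import Relation.Nullary.Decidable using (⌊_⌋; toWitness; fromWitness; _×-dec_)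

-- Asymptotics

^-distribʳ-* : ∀ x y k → (x * y) ^ k ≡ x ^ k * y ^ k
^-distribʳ-* x y zero    = refl
^-distribʳ-* x y (suc k) =
  trans (cong (x * y *_) (^-distribʳ-* x y k)) (interchange x y (x ^ k) (y ^ k))
  where
  interchange : ∀ a b c d → a * b * (c * d) ≡ a * c * (b * d)
  interchange = solve-∀

square-cancel-≤ : ∀ {m n} → m * m ≤ n * n → m ≤ n
square-cancel-≤ mm≤nn = ≮⇒≥ λ n<m → <⇒≱ (*-mono-< n<m n<m) mm≤nn

n<2^n : ∀ n → n < 2 ^ n
n<2^n zero    = z<s
n<2^n (suc n) = begin-strict
  suc n          ≤⟨ n<2^n n ⟩
  2 ^ n          <⟨ m<m+n (2 ^ n) (m^n>0 2 n) ⟩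
  2 ^ n + 2 ^ n  ≡⟨ cong (2 ^ n +_) (+-identityʳ (2 ^ n)) ⟨
  2 ^ suc n      ∎
  where open ≤-Reasoning

n<2^1+log₂n : ∀ n → n < 2 ^ suc ⌊log₂ n ⌋
n<2^1+log₂n n = ≰⇒> λ 2^≤n → n≮n ⌊log₂ n ⌋
  (subst (_≤ ⌊log₂ n ⌋) (⌊log₂[2^n]⌋≡n (suc ⌊log₂ n ⌋)) (⌊log₂⌋-mono-≤ 2^≤n))

2^log₂n≤n : ∀ n .{{_ : NonZero n}} → 2 ^ ⌊log₂ n ⌋ ≤ n
2^log₂n≤n = <-rec (λ n → .{{_ : NonZero n}} → 2 ^ ⌊log₂ n ⌋ ≤ n) step
  where
  step : ∀ n → (∀ {m} → m < n → .{{_ : NonZero m}} → 2 ^ ⌊log₂ m ⌋ ≤ m) →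
         .{{_ : NonZero n}} → 2 ^ ⌊log₂ n ⌋ ≤ n
  step 1                rec = ≤-refl
  step n@(suc (suc n′)) rec = begin
    2 ^ ⌊log₂ n ⌋                ≡⟨ cong (2 ^_) (m+[n∸m]≡n 1≤log) ⟨
    2 ^ suc (⌊log₂ n ⌋ ∸ 1)      ≡⟨ cong (λ l → 2 ^ suc l) (⌊log₂⌊n/2⌋⌋≡⌊log₂n⌋∸1 n) ⟨
    2 * 2 ^ ⌊log₂ ⌊ n /2⌋ ⌋      ≤⟨ *-monoʳ-≤ 2 (rec (⌊n/2⌋<n (suc n′))) ⟩
    2 * ⌊ n /2⌋                  ≡⟨ cong (⌊ n /2⌋ +_) (+-identityʳ ⌊ n /2⌋) ⟩
    ⌊ n /2⌋ + ⌊ n /2⌋            ≤⟨ +-monoʳ-≤ ⌊ n /2⌋ (⌊n/2⌋≤⌈n/2⌉ n) ⟩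
    ⌊ n /2⌋ + ⌈ n /2⌉            ≡⟨ ⌊n/2⌋+⌈n/2⌉≡n n ⟩
    n                            ∎
    where
    open ≤-Reasoning
    1≤log : 1 ≤ ⌊log₂ n ⌋
    1≤log = ⌊log₂⌋-mono-≤ {2} {n} (s≤s (s≤s z≤n))

-- The exponential is split evenly over the m factors: 1 + l ≤ m · 2^(l / m).
polynomial≤exponential : ∀ m l → (1 + l) ^ m ≤ m ^ m * 2 ^ l
polynomial≤exponential zero      l = subst (1 ≤_) (sym (*-identityˡ (2 ^ l))) (m^n>0 2 l)
polynomial≤exponential m@(suc _) l = begin
  (1 + l) ^ m                  ≤⟨ ^-monoˡ-≤ m 1+l≤ ⟩
  (m * 2 ^ (l / m)) ^ m        ≡⟨ ^-distribʳ-* m (2 ^ (l / m)) m ⟩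
  m ^ m * (2 ^ (l / m)) ^ m    ≡⟨ cong (m ^ m *_) (^-*-assoc 2 (l / m) m) ⟩
  m ^ m * 2 ^ (l / m * m)      ≤⟨ *-monoʳ-≤ (m ^ m) (^-monoʳ-≤ 2 (m/n*n≤m l m)) ⟩
  m ^ m * 2 ^ l                ∎
  where
  open ≤-Reasoning
  1+l≤ : 1 + l ≤ m * 2 ^ (l / m)
  1+l≤ = begin
    1 + l                        ≡⟨ cong suc (m≡m%n+[m/n]*n l m) ⟩
    suc (l % m) + l / m * m      ≤⟨ +-monoˡ-≤ (l / m * m) (m%n<n l m) ⟩
    suc (l / m) * m              ≤⟨ *-monoˡ-≤ m (n<2^n (l / m)) ⟩
    2 ^ (l / m) * m              ≡⟨ *-comm (2 ^ (l / m)) m ⟩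
    m * 2 ^ (l / m)              ∎

polylog≤linear : ∀ m n .{{_ : NonZero n}} → (1 + ⌊log₂ n ⌋) ^ m ≤ m ^ m * n
polylog≤linear m n =
  ≤-trans (polynomial≤exponential m ⌊log₂ n ⌋) (*-monoʳ-≤ (m ^ m) (2^log₂n≤n n))

log₂[c*1+n]≤ : ∀ c n → ⌊log₂ (c * suc n) ⌋ ≤ c + suc ⌊log₂ n ⌋
log₂[c*1+n]≤ c n = begin
  ⌊log₂ (c * suc n) ⌋                   ≤⟨ ⌊log₂⌋-mono-≤ (*-mono-≤ (<⇒≤ (n<2^n c)) (n<2^1+log₂n n)) ⟩
  ⌊log₂ (2 ^ c * 2 ^ suc ⌊log₂ n ⌋) ⌋   ≡⟨ cong ⌊log₂_⌋ (^-distribˡ-+-* 2 c (suc ⌊log₂ n ⌋)) ⟨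
  ⌊log₂ (2 ^ (c + suc ⌊log₂ n ⌋)) ⌋     ≡⟨ ⌊log₂[2^n]⌋≡n (c + suc ⌊log₂ n ⌋) ⟩
  c + suc ⌊log₂ n ⌋                     ∎
  where open ≤-Reasoning

n≤c*1+n : ∀ c .{{_ : NonZero c}} n → n ≤ c * suc n
n≤c*1+n c n = ≤-trans (n≤1+n n) (m≤n*m (suc n) c)

c*1+n≤2c*n : ∀ c n .{{_ : NonZero n}} → c * suc n ≤ 2 * c * n
c*1+n≤2c*n c n = begin
  c * suc n    ≤⟨ *-monoʳ-≤ c (+-monoˡ-≤ n (>-nonZero⁻¹ n)) ⟩
  c * (n + n)  ≡⟨ lemma c n ⟩
  2 * c * n    ∎
  where
  open ≤-Reasoning
  lemma : ∀ c n → c * (n + n) ≡ 2 * c * n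
  lemma = solve-∀

wordLength-rescale : ∀ c .{{_ : NonZero c}} {w} →
                     WordLength w → WordLength (λ n → w (c * suc n))
wordLength-rescale c {w} (lower , d , upper) = lower′ , d * (2 + c) , upper′
  where
  open ≤-Reasoning
  lower′ : ∀ n → 1 + ⌊log₂ n ⌋ ≤ w (c * suc n)
  lower′ n = ≤-trans (s≤s (⌊log₂⌋-mono-≤ (n≤c*1+n c n))) (lower (c * suc n))
  upper′ : ∀ n → w (c * suc n) ≤ d * (2 + c) * (1 + ⌊log₂ n ⌋)
  upper′ n = begin
    w (c * suc n)                        ≤⟨ upper (c * suc n) ⟩
    d * (1 + ⌊log₂ (c * suc n) ⌋)        ≤⟨ *-monoʳ-≤ d (s≤s (log₂[c*1+n]≤ c n)) ⟩
    d * (1 + (c + suc ⌊log₂ n ⌋))        ≤⟨ *-monoʳ-≤ d (+-monoˡ-≤ _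
                                              (m≤m*n (1 + c) (1 + ⌊log₂ n ⌋))) ⟩
    d * ((1 + c) * (1 + ⌊log₂ n ⌋) + (1 + ⌊log₂ n ⌋)) ≡⟨ lemma d c (1 + ⌊log₂ n ⌋) ⟩
    d * (2 + c) * (1 + ⌊log₂ n ⌋)        ∎
    where
    lemma : ∀ d c l → d * ((1 + c) * l + l) ≡ d * (2 + c) * l
    lemma = solve-∀

subpolynomial-rescale : ∀ a b c .{{_ : NonZero c}} {g} →
                        Subpolynomial g → Subpolynomial (λ N → a * g (c * suc N) + b)
subpolynomial-rescale a b c {g} g-sub k 1≤k = suc (N₀ + K * (2 * c)) , λ N large →
  square-cancel-≤ (bound N {{>-nonZero (≤-trans z<s large)}} (<⇒≤ large))
  where
  open ≤-Reasoning
  g-small = g-sub (2 * k) (≤-trans 1≤k (m≤n*m k 2))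
  N₀ = proj₁ g-small
  g^2k≤ = proj₂ g-small
  K = (a + b) ^ (2 * k)
  bound : ∀ N .{{_ : NonZero N}} → N₀ + K * (2 * c) ≤ N →
          (a * g (c * suc N) + b) ^ k * (a * g (c * suc N) + b) ^ k ≤ N * N
  bound N large = begin
    X ^ k * X ^ k                    ≡⟨ ^-distribˡ-+-* X k k ⟨
    X ^ (k + k)                      ≡⟨ cong (λ i → X ^ (k + i)) (+-identityʳ k) ⟨
    X ^ (2 * k)                      ≤⟨ ^-monoˡ-≤ (2 * k) X≤ ⟩
    ((a + b) * G) ^ (2 * k)          ≡⟨ ^-distribʳ-* (a + b) G (2 * k) ⟩
    K * G ^ (2 * k)                  ≤⟨ *-monoʳ-≤ K G^2k≤n ⟩
    K * n                            ≤⟨ *-monoʳ-≤ K (c*1+n≤2c*n c N) ⟩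
    K * (2 * c * N)                  ≡⟨ *-assoc K (2 * c) N ⟨
    K * (2 * c) * N                  ≤⟨ *-monoˡ-≤ N (m+n≤o⇒n≤o N₀ large) ⟩
    N * N                            ∎
    where
    n = c * suc N
    X = a * g n + b
    G = g n ⊔ 1
    X≤ : X ≤ (a + b) * G
    X≤ = begin
      a * g n + b    ≤⟨ +-mono-≤ (*-monoʳ-≤ a (m≤m⊔n (g n) 1))
                                 (≤-trans (≤-reflexive (sym (*-identityʳ b)))
                                          (*-monoʳ-≤ b (m≤n⊔m (g n) 1))) ⟩
      a * G + b * G  ≡⟨ *-distribʳ-+ G a b ⟨
      (a + b) * G    ∎
    G^2k≤n : G ^ (2 * k) ≤ n
    G^2k≤n with ⊔-sel (g n) 1
    ... | inj₁ G≡ = subst (λ x → x ^ (2 * k) ≤ n) (sym G≡)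
                      (g^2k≤ n (≤-trans (m+n≤o⇒m≤o N₀ large) (n≤c*1+n c N)))
    ... | inj₂ G≡ = subst (λ x → x ^ (2 * k) ≤ n) (sym G≡)
                      (subst (_≤ n) (sym (^-zeroˡ (2 * k))) (≤-trans (>-nonZero⁻¹ N) (n≤c*1+n c N)))

-- Raising n ≤ b · y · z to the fourth power leaves room for both y and z
-- to be as large as the fourth root of n.
bounded-of-fourth-powers : ∀ {b m n y z} .{{_ : NonZero n}} →
  n ≤ b * (y * z) → y ^ 4 ≤ m * n → z ^ 4 ≤ n → n ≤ b ^ 4 * m
bounded-of-fourth-powers {b} {m} {n} {y} {z} n≤byz y⁴≤mn z⁴≤n =
  ≤-trans (m≤m*n n n) (*-cancelʳ-≤ (n * n) (b ^ 4 * m) (n * n) {{m*n≢0 n n}} (begin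
    n * n * (n * n)          ≡⟨ fourth n ⟨
    n ^ 4                    ≤⟨ ^-monoˡ-≤ 4 n≤byz ⟩
    (b * (y * z)) ^ 4        ≡⟨ ^-distribʳ-* b (y * z) 4 ⟩
    b ^ 4 * (y * z) ^ 4      ≡⟨ cong (b ^ 4 *_) (^-distribʳ-* y z 4) ⟩
    b ^ 4 * (y ^ 4 * z ^ 4)  ≤⟨ *-monoʳ-≤ (b ^ 4) (*-mono-≤ y⁴≤mn z⁴≤n) ⟩
    b ^ 4 * (m * n * n)      ≡⟨ regroup (b ^ 4) m n ⟩
    b ^ 4 * m * (n * n)      ∎))
  where
  open ≤-Reasoning
  fourth : ∀ n → n * (n * (n * (n * 1))) ≡ n * n * (n * n)
  fourth = solve-∀
  regroup : ∀ b m n → b * (m * n * n) ≡ b * m * (n * n)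
  regroup = solve-∀

space-bounds-incompatible :
  ∀ c .{{_ : NonZero c}} {T s : ℕ → ℕ} {p q} → 1 ≤ p → 1 ≤ q → Subpolynomial T →
  Ω̃[N²/ T ²] (λ N → s (c * suc N)) →
  ¬ (∃[ C ] Eventually λ n → s n ^ q * n ^ p ≤ C * n ^ (2 * q))
space-bounds-incompatible c {T} {s} {p} {q} 1≤p 1≤q T-sub
  (C , k , N₁ , lower) (C′ , N₂ , upper)
  with T-sub (2 * q * 4) (≤-trans 1≤q (≤-trans (m≤n*m q 2) (m≤m*n (2 * q) 4)))
... | N₃ , T^8q≤ = n≮n (b ^ 4 * m) (≤-trans large
    (bounded-of-fourth-powers {b} {m} {N} {L ^ (k * q)} {T N ^ (2 * q)} N≤
      (≤-trans (≤-reflexive (^-*-assoc L (k * q) 4)) (polylog≤linear (k * q * 4) N))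
      (≤-trans (≤-reflexive (^-*-assoc (T N) (2 * q) 4)) (T^8q≤ N N₃≤N))))
  where
  open ≤-Reasoning
  b = C ^ q * (C′ * (2 * c) ^ (2 * q))
  m = (k * q * 4) ^ (k * q * 4)
  N = suc (N₁ + N₂ + N₃ + b ^ 4 * m)
  n = c * suc N
  L = 1 + ⌊log₂ N ⌋
  D = C * L ^ k * T N ^ 2
  large : suc (b ^ 4 * m) ≤ N
  large = s≤s (m≤n+m _ (N₁ + N₂ + N₃))
  N₃≤N : N₃ ≤ N
  N₃≤N = ≤-trans (m≤n+m N₃ (N₁ + N₂)) (≤-trans (m≤m+n _ (b ^ 4 * m)) (n≤1+n _))
  N₁+N₂≤N : N₁ + N₂ ≤ N
  N₁+N₂≤N = ≤-trans (m≤m+n (N₁ + N₂) N₃) (≤-trans (m≤m+n _ (b ^ 4 * m)) (n≤1+n _))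
  D^q≡ : D ^ q ≡ C ^ q * (L ^ (k * q) * T N ^ (2 * q))
  D^q≡ = begin-equality
    D ^ q                                     ≡⟨ ^-distribʳ-* (C * L ^ k) (T N ^ 2) q ⟩
    (C * L ^ k) ^ q * (T N ^ 2) ^ q           ≡⟨ cong₂ _*_ (^-distribʳ-* C (L ^ k) q)
                                                            (^-*-assoc (T N) 2 q) ⟩
    C ^ q * (L ^ k) ^ q * T N ^ (2 * q)       ≡⟨ cong (λ x → C ^ q * x * T N ^ (2 * q))
                                                      (^-*-assoc L k q) ⟩
    C ^ q * L ^ (k * q) * T N ^ (2 * q)       ≡⟨ *-assoc (C ^ q) _ _ ⟩
    C ^ q * (L ^ (k * q) * T N ^ (2 * q))     ∎
  regroup : ∀ c yz c′ d x → c * yz * (c′ * (d * x)) ≡ c * (c′ * d) * yz * x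
  regroup = solve-∀
  N≤ : N ≤ b * (L ^ (k * q) * T N ^ (2 * q))
  N≤ = *-cancelʳ-≤ N _ (N ^ (2 * q)) {{m^n≢0 N (2 * q)}} (begin
    N * N ^ (2 * q)                          ≡⟨ *-comm N (N ^ (2 * q)) ⟩
    N ^ (2 * q) * N                          ≡⟨ cong (N ^ (2 * q) *_) (*-identityʳ N) ⟨
    N ^ (2 * q) * N ^ 1                      ≤⟨ *-monoʳ-≤ (N ^ (2 * q)) (^-monoʳ-≤ N 1≤p) ⟩
    N ^ (2 * q) * N ^ p                      ≡⟨ cong (_* N ^ p) (^-*-assoc N 2 q) ⟨
    (N ^ 2) ^ q * N ^ p                      ≤⟨ *-mono-≤ (^-monoˡ-≤ q (lower N (m+n≤o⇒m≤o N₁ N₁+N₂≤N)))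
                                                         (^-monoˡ-≤ p (n≤c*1+n c N)) ⟩
    (D * s n) ^ q * n ^ p                    ≡⟨ cong (_* n ^ p) (^-distribʳ-* D (s n) q) ⟩
    D ^ q * s n ^ q * n ^ p                  ≡⟨ *-assoc (D ^ q) _ _ ⟩
    D ^ q * (s n ^ q * n ^ p)                ≤⟨ *-monoʳ-≤ (D ^ q) (upper n
                                                  (≤-trans (m+n≤o⇒n≤o N₁ N₁+N₂≤N) (n≤c*1+n c N))) ⟩
    D ^ q * (C′ * n ^ (2 * q))               ≤⟨ *-monoʳ-≤ (D ^ q) (*-monoʳ-≤ C′
                                                  (^-monoˡ-≤ (2 * q) (c*1+n≤2c*n c N))) ⟩
    D ^ q * (C′ * (2 * c * N) ^ (2 * q))     ≡⟨ cong₂ (λ x y → x * (C′ * y)) D^q≡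
                                                  (^-distribʳ-* (2 * c) N (2 * q)) ⟩
    C ^ q * (L ^ (k * q) * T N ^ (2 * q)) * (C′ * ((2 * c) ^ (2 * q) * N ^ (2 * q)))
                                             ≡⟨ regroup (C ^ q) _ C′ ((2 * c) ^ (2 * q)) (N ^ (2 * q)) ⟩
    b * (L ^ (k * q) * T N ^ (2 * q)) * N ^ (2 * q) ∎)

-- Word RAM programs

≡ᵇ-refl : ∀ n → (n ≡ᵇ n) ≡ true
≡ᵇ-refl n = Equivalence.to T-≡ (≡⇒≡ᵇ n n refl)

≢⇒≡ᵇ≡false : ∀ {m n} → m ≢ n → (m ≡ᵇ n) ≡ false
≢⇒≡ᵇ≡false {m} {n} m≢n with m ≡ᵇ n in m≡ᵇn
... | false = refl
... | true  = contradiction (≡ᵇ⇒≡ m n (Equivalence.from T-≡ m≡ᵇn)) m≢n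

val-wrap : ∀ {w} x → val (wrap {w} x) ≡ _%_ x (2 ^ w) {{m^n≢0 2 w}}
val-wrap x = toℕ-fromℕ< _

val-wrap-< : ∀ {w x} → x < 2 ^ w → val (wrap {w} x) ≡ x
val-wrap-< {w} {x} x<2^w = trans (val-wrap {w} x) (m<n⇒m%n≡m {{m^n≢0 2 w}} x<2^w)

val-wrap-0 : ∀ {w} → val (wrap {w} 0) ≡ 0
val-wrap-0 {w} = val-wrap-< {w} (m^n>0 2 w)

wrap-cong-% : ∀ {w x y} → _%_ x (2 ^ w) {{m^n≢0 2 w}} ≡ _%_ y (2 ^ w) {{m^n≢0 2 w}} →
              wrap {w} x ≡ wrap y
wrap-cong-% x≡y = cong word (toℕ-injective (trans (toℕ-fromℕ< _) (trans x≡y (sym (toℕ-fromℕ< _)))))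

eval-add-wrap : ∀ {w} x y → eval {w} add (wrap x) (wrap y) ≡ wrap (x + y)
eval-add-wrap {w} x y = trans (cong wrap (cong₂ _+_ (val-wrap {w} x) (val-wrap {w} y)))
  (wrap-cong-% (sym (%-distribˡ-+ x y (2 ^ w) {{m^n≢0 2 w}})))

registerBound : Prog → ℕ
registerBound skip          = 0
registerBound (p ⨾ q)       = registerBound p ⊔ registerBound q
registerBound (set r _)     = suc r
registerBound (op _ r a b)  = suc r ⊔ (suc a ⊔ suc b)
registerBound (load _ r a)  = suc r ⊔ suc a
registerBound (save _ a r)  = suc a ⊔ suc r
registerBound (ifnz r p q)  = suc r ⊔ (registerBound p ⊔ registerBound q)
registerBound (while r p)   = suc r ⊔ registerBound p

record AgreeBelow {w} (k : ℕ) (σ τ : State w) : Set where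
  field
    registers : ∀ r → r < k → reg σ r ≡ reg τ r
    memory    : ∀ g a → mem g σ a ≡ mem g τ a

open AgreeBelow

AgreeFrom : ∀ {w} (k : ℕ) (σ τ : State w) → Set
AgreeFrom k σ τ = ∀ r → k ≤ r → reg σ r ≡ reg τ r

≔-other : ∀ {w} (σ : State w) r x {r′} → r′ ≢ r → reg (σ [ r ≔ x ]) r′ ≡ reg σ r′
≔-other σ r x r′≢r rewrite ≢⇒≡ᵇ≡false r′≢r = refl

≔-agreeBelow : ∀ {w k r x y} {σ τ : State w} → AgreeBelow k σ τ → x ≡ y →
               AgreeBelow k (σ [ r ≔ x ]) (τ [ r ≔ y ])
≔-agreeBelow {r = r} σ≈τ refl .registers r′ r′<k with r′ ≡ᵇ r
... | true  = refl
... | false = registers σ≈τ r′ r′<k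
≔-agreeBelow σ≈τ x≡y .memory store a = memory σ≈τ store a
≔-agreeBelow σ≈τ x≡y .memory args  a = memory σ≈τ args a

≔-agreeFrom : ∀ {w k r x} {τ : State w} → r < k → AgreeFrom k (τ [ r ≔ x ]) τ
≔-agreeFrom {r = r} {x} {τ} r<k r′ k≤r′ =
  ≔-other τ r x λ r′≡r → <⇒≱ r<k (subst (_ ≤_) r′≡r k≤r′)

updᵐ-cong : ∀ {w} {m m′ : Memory w} {a a′ x x′} →
            (∀ b → m b ≡ m′ b) → a ≡ a′ → x ≡ x′ → ∀ b → updᵐ m a x b ≡ updᵐ m′ a′ x′ b
updᵐ-cong {a = a} m≗m′ refl refl b with val b ≡ᵇ val a
... | true  = refl
... | false = m≗m′ b

write-agreeBelow : ∀ {w k} g {a a′ x x′} {σ τ : State w} →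
                   AgreeBelow k σ τ → a ≡ a′ → x ≡ x′ →
                   AgreeBelow k (write g a x σ) (write g a′ x′ τ)
write-agreeBelow store σ≈τ a≡ x≡ .registers        = registers σ≈τ
write-agreeBelow args  σ≈τ a≡ x≡ .registers        = registers σ≈τ
write-agreeBelow store σ≈τ a≡ x≡ .memory store = updᵐ-cong (memory σ≈τ store) a≡ x≡
write-agreeBelow store σ≈τ a≡ x≡ .memory args  = memory σ≈τ args
write-agreeBelow args  σ≈τ a≡ x≡ .memory store = memory σ≈τ store
write-agreeBelow args  σ≈τ a≡ x≡ .memory args  = updᵐ-cong (memory σ≈τ args) a≡ x≡

write-reg : ∀ {w} g {a x} (σ : State w) → reg (write g a x σ) ≡ reg σ
write-reg store σ = refl
write-reg args  σ = refl

frame : ∀ {w k p t} {σ σ′ τ : State w} → p ∶ σ ⇓[ t ] σ′ → registerBound p ≤ k →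
        AgreeBelow k σ τ →
        ∃[ τ′ ] (p ∶ τ ⇓[ t ] τ′) × AgreeBelow k σ′ τ′ × AgreeFrom k τ′ τ
frame skip⇓ p≤k σ≈τ = _ , skip⇓ , σ≈τ , λ _ _ → refl
frame {p = p ⨾ q} (seq⇓ d e) p≤k σ≈τ
  with _ , d′ , σ≈τ′ , from  ← frame d (m⊔n≤o⇒m≤o (registerBound p) (registerBound q) p≤k) σ≈τ
  with _ , e′ , σ≈τ″ , from′ ← frame e (m⊔n≤o⇒n≤o (registerBound p) (registerBound q) p≤k) σ≈τ′
  = _ , seq⇓ d′ e′ , σ≈τ″ , λ r k≤r → trans (from′ r k≤r) (from r k≤r)
frame {τ = τ} set⇓ p≤k σ≈τ = _ , set⇓ , ≔-agreeBelow σ≈τ refl , ≔-agreeFrom {τ = τ} p≤k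
frame {p = op o r a b} {τ = τ} op⇓ p≤k σ≈τ =
  _ , op⇓ , ≔-agreeBelow σ≈τ (cong₂ (eval o) (registers σ≈τ a (m⊔n≤o⇒m≤o (suc a) (suc b) ab≤k))
                                             (registers σ≈τ b (m⊔n≤o⇒n≤o (suc a) (suc b) ab≤k)))
    , ≔-agreeFrom {τ = τ} (m⊔n≤o⇒m≤o (suc r) (suc a ⊔ suc b) p≤k)
  where ab≤k = m⊔n≤o⇒n≤o (suc r) (suc a ⊔ suc b) p≤k
frame {p = load g r a} {σ = σ} {τ = τ} load⇓ p≤k σ≈τ =
  _ , load⇓ , ≔-agreeBelow σ≈τ (trans (memory σ≈τ g (reg σ a))
                                 (cong (mem g τ) (registers σ≈τ a (m⊔n≤o⇒n≤o (suc r) (suc a) p≤k))))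
    , ≔-agreeFrom {τ = τ} (m⊔n≤o⇒m≤o (suc r) (suc a) p≤k)
frame {p = save g a r} {τ = τ} save⇓ p≤k σ≈τ =
  _ , save⇓ , write-agreeBelow g σ≈τ (registers σ≈τ a (m⊔n≤o⇒m≤o (suc a) (suc r) p≤k))
                                     (registers σ≈τ r (m⊔n≤o⇒n≤o (suc a) (suc r) p≤k))
    , λ r′ _ → cong (λ ρ → ρ r′) (write-reg g τ)
frame {p = ifnz r p q} (if⇓ r≢0 d) bound σ≈τ
  with r<k  ← m⊔n≤o⇒m≤o (suc r) (registerBound p ⊔ registerBound q) bound
     | pq≤k ← m⊔n≤o⇒n≤o (suc r) (registerBound p ⊔ registerBound q) bound
  with _ , d′ , σ≈τ′ , from ← frame d (m⊔n≤o⇒m≤o (registerBound p) (registerBound q) pq≤k) σ≈τ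
  = _ , if⇓ (r≢0 ∘ trans (cong val (registers σ≈τ r r<k))) d′ , σ≈τ′ , from
frame {p = ifnz r p q} (else⇓ r≡0 d) bound σ≈τ
  with r<k  ← m⊔n≤o⇒m≤o (suc r) (registerBound p ⊔ registerBound q) bound
     | pq≤k ← m⊔n≤o⇒n≤o (suc r) (registerBound p ⊔ registerBound q) bound
  with _ , d′ , σ≈τ′ , from ← frame d (m⊔n≤o⇒n≤o (registerBound p) (registerBound q) pq≤k) σ≈τ
  = _ , else⇓ (trans (cong val (sym (registers σ≈τ r r<k))) r≡0) d′ , σ≈τ′ , from
frame {p = while r p} (loop⇓ r≢0 d e) bound σ≈τ
  with r<k ← m⊔n≤o⇒m≤o (suc r) (registerBound p) bound
     | p≤k ← m⊔n≤o⇒n≤o (suc r) (registerBound p) bound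
  with _ , d′ , σ≈τ′ , from  ← frame d p≤k σ≈τ
  with _ , e′ , σ≈τ″ , from′ ← frame e bound σ≈τ′
  = _ , loop⇓ (r≢0 ∘ trans (cong val (registers σ≈τ r r<k))) d′ e′
      , σ≈τ″ , λ r′ k≤r′ → trans (from′ r′ k≤r′) (from r′ k≤r′)
frame {p = while r p} (done⇓ r≡0) bound σ≈τ
  with r<k ← m⊔n≤o⇒m≤o (suc r) (registerBound p) bound
  = _ , done⇓ (trans (cong val (sym (registers σ≈τ r r<k))) r≡0) , σ≈τ , λ _ _ → refl

-- The registers k and k + 1 survive the update, which only uses those below k.
saveVertices : ℕ → Prog
saveVertices k =
  op add k 0 0 ⨾ op add (suc k) 1 1 ⨾ set 1 1 ⨾ op add (suc k) (suc k) 1 ⨾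
  save args 1 (suc k) ⨾ set 1 0 ⨾ save args 1 k ⨾ set 0 2

restoreVertices : ℕ → Prog
restoreVertices k = set 0 0 ⨾ op add 1 (suc k) 0 ⨾ op add 0 k 0

negate : Prog
negate = set 1 0 ⨾ op eq 0 0 1

freshRegister : Prog → Prog → ℕ
freshRegister update query = 2 + (registerBound update ⊔ registerBound query)

disjointnessProgram : Prog → Prog → Prog
disjointnessProgram update query =
  saveVertices k ⨾ update ⨾ restoreVertices k ⨾ query ⨾ negate
  where k = freshRegister update query

updᵐ-fill₂ : ∀ {w} → 1 ≤ w → (x y : Word w) → ∀ a →
             fill (x ∷ y ∷ []) a ≡ updᵐ (updᵐ zeros (wrap 1) y) (wrap 0) x a
updᵐ-fill₂ {w} 1≤w x y a
  rewrite val-wrap-0 {w} | val-wrap-< {w} {1} (^-monoʳ-≤ 2 1≤w) with val a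
... | 0           = refl
... | 1           = refl
... | suc (suc _) = refl

saveVertices-correct :
  ∀ {w} → 1 ≤ w → (m : Memory w) (l i j : ℕ) → let k = 2 + l in
  ∃[ τ ] (saveVertices k ∶ withQuery i j (initial m zeros) ⇓[ 8 ] τ) ×
    AgreeBelow k (initial m (fill (wrap (2 * i) ∷ wrap (suc (2 * j)) ∷ [])) [ 0 ≔ wrap 2 ]) τ ×
    reg τ k ≡ wrap (2 * i) × reg τ (suc k) ≡ wrap (suc (2 * j))
saveVertices-correct {w} 1≤w m l i j =
  τ , seq⇓ op⇓ (seq⇓ op⇓ (seq⇓ set⇓ (seq⇓ op⇓ (seq⇓ save⇓ (seq⇓ set⇓ (seq⇓ save⇓ set⇓))))))
    , record { registers = regs ; memory = mems } , reg-k , reg-1+k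
  where
  k = 2 + l
  x y : Word w
  x = wrap (2 * i)
  y = wrap (suc (2 * j))
  σ₀ σ₁ σ₂ σ₃ τ : State w
  σ₀ = withQuery i j (initial m zeros)
  σ₁ = σ₀ [ k ≔ eval add (reg σ₀ 0) (reg σ₀ 0) ]
  σ₂ = σ₁ [ suc k ≔ eval add (reg σ₁ 1) (reg σ₁ 1) ] [ 1 ≔ wrap 1 ]
  σ₃ = σ₂ [ suc k ≔ eval add (reg σ₂ (suc k)) (reg σ₂ 1) ]
  τ = write args (wrap 0) (reg σ₃ k)
        (write args (wrap 1) (reg σ₃ (suc k)) σ₃ [ 1 ≔ wrap 0 ]) [ 0 ≔ wrap 2 ]
  regs : ∀ r → r < k → reg (initial m (fill (x ∷ y ∷ [])) [ 0 ≔ wrap 2 ]) r ≡ reg τ r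
  regs 0             r<k = refl
  regs 1             r<k = refl
  regs (suc (suc r)) (s≤s (s≤s r<l))
    rewrite ≢⇒≡ᵇ≡false (<⇒≢ r<l) | ≢⇒≡ᵇ≡false (<⇒≢ (m<n⇒m<1+n r<l)) = refl
  reg-k : reg σ₃ k ≡ x
  reg-k rewrite ≢⇒≡ᵇ≡false (<⇒≢ (n<1+n l)) | ≡ᵇ-refl l =
    trans (eval-add-wrap i i) (cong (λ n → wrap (i + n)) (sym (+-identityʳ i)))
  reg-1+k : reg σ₃ (suc k) ≡ y
  reg-1+k rewrite ≡ᵇ-refl l =
    trans (cong (λ n → eval add n (wrap 1)) (eval-add-wrap j j))
      (trans (eval-add-wrap (j + j) 1) (cong wrap (lemma j)))
    where
    lemma : ∀ j → j + j + 1 ≡ suc (2 * j)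
    lemma = solve-∀
  mems : ∀ g a → mem g (initial m (fill (x ∷ y ∷ [])) [ 0 ≔ wrap 2 ]) a ≡ mem g τ a
  mems store a = refl
  mems args  a = trans (updᵐ-fill₂ 1≤w x y a)
    (updᵐ-cong (updᵐ-cong (λ _ → refl) refl (sym reg-1+k)) refl (sym reg-k) a)

negate-correct : ∀ {w} {σ : State w} {P Q : Set} → 1 ≤ w → (P → ¬ Q) → (¬ P → Q) →
                 Decides P σ → Within 2 negate σ (Decides Q)
negate-correct {w} {σ} {P} {Q} 1≤w P→¬Q ¬P→Q decides =
  2 , _ , seq⇓ set⇓ op⇓ , ≤-refl , flip decides
  where
  σ₁ = σ [ 1 ≔ wrap 0 ]
  flip : Decides P σ → Decides Q (σ₁ [ 0 ≔ eval eq (reg σ₁ 0) (reg σ₁ 1) ])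
  flip (inj₁ (r₀≡1 , p)) rewrite r₀≡1 | val-wrap-0 {w} = inj₂ (val-wrap-0 {w} , P→¬Q p)
  flip (inj₂ (r₀≡0 , ¬p)) rewrite r₀≡0 | val-wrap-0 {w} =
    inj₁ (val-wrap-< {w} (^-monoʳ-≤ 2 1≤w) , ¬P→Q ¬p)

restoreVertices-correct :
  ∀ {w l x y} {σ τ : State w} → let k = 2 + l in
  AgreeBelow k σ τ → reg τ k ≡ wrap x → reg τ (suc k) ≡ wrap y →
  ∃[ τ′ ] (restoreVertices k ∶ τ ⇓[ 3 ] τ′) × AgreeBelow k (withQuery x y σ) τ′
restoreVertices-correct {w} {l} {x} {y} {σ} {τ} σ≈τ τk≡x τ1+k≡y =
  _ , seq⇓ set⇓ (seq⇓ op⇓ op⇓) , record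
    { registers = λ where
        0             _    → sym (plus-0 τk≡x)
        1             _    → sym (plus-0 τ1+k≡y)
        (suc (suc r)) r<k  → registers σ≈τ (suc (suc r)) r<k
    ; memory    = λ where
        store a → memory σ≈τ store a
        args  a → memory σ≈τ args a
    }
  where
  plus-0 : ∀ {z n} → z ≡ wrap {w} n → eval add z (wrap 0) ≡ wrap n
  plus-0 {n = n} refl = trans (eval-add-wrap n 0) (cong wrap (+-identityʳ n))

disjointnessProgram-correct :
  ∀ {w update query t i j} {P Q : Set} {m : Memory w} → 1 ≤ w → (P → ¬ Q) → (¬ P → Q) →
  let u = 2 * i ; v = suc (2 * j) in
  Within t update (initial m (fill (wrap u ∷ wrap v ∷ [])) [ 0 ≔ wrap 2 ])
    (λ σ → Within t query (withQuery u v σ) (Decides P)) →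
  Within (2 * t + 13) (disjointnessProgram update query)
    (withQuery i j (initial m zeros)) (Decides Q)
disjointnessProgram-correct {w} {update} {query} {t} {i} {j} {P} {Q} {m} 1≤w P→¬Q ¬P→Q
  (t₁ , _ , run-update , t₁≤t , t₂ , σ₂ , run-query , t₂≤t , decides)
  with l ← registerBound update ⊔ registerBound query in l≡
  with _ , saved , agree , τk≡ , τ1+k≡ ← saveVertices-correct 1≤w m l i j
  with _ , updated , agree₁ , from₁ ← frame run-update
    (≤-trans (m≤m⊔n _ _) (≤-trans (≤-reflexive l≡) (m≤n+m l 2))) agree
  with _ , restored , agree₂ ← restoreVertices-correct agree₁
    (trans (from₁ _ ≤-refl) τk≡) (trans (from₁ _ (n≤1+n _)) τ1+k≡)
  with τ₂ , queried , agree₃ , _ ← frame run-query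
    (≤-trans (m≤n⊔m (registerBound update) _) (≤-trans (≤-reflexive l≡) (m≤n+m l 2))) agree₂
  with t₃ , _ , negated , t₃≤2 , decided ← negate-correct {σ = τ₂} 1≤w P→¬Q ¬P→Q
    (subst (λ r → (val r ≡ 1 × P) ⊎ (val r ≡ 0 × ¬ P)) (registers agree₃ 0 z<s) decides)
  = _ , _ , seq⇓ saved (seq⇓ updated (seq⇓ restored (seq⇓ queried negated))) , time , decided
  where
  open ≤-Reasoning
  regroup : ∀ t → 8 + (t + (3 + (t + 2))) ≡ 2 * t + 13
  regroup = solve-∀
  time : 8 + (t₁ + (3 + (t₂ + t₃))) ≤ 2 * t + 13
  time = begin
    8 + (t₁ + (3 + (t₂ + t₃)))  ≤⟨ +-monoʳ-≤ 8 (+-mono-≤ t₁≤t (+-monoʳ-≤ 3 (+-mono-≤ t₂≤t t₃≤2))) ⟩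
    8 + (t + (3 + (t + 2)))     ≡⟨ regroup t ⟩
    2 * t + 13                  ∎

-- The graph of a set family

length-concat-map : ∀ {A B : Set} (f : A → List B) xs →
                    length (concat (map f xs)) ≡ sum (map (length ∘ f) xs)
length-concat-map f []       = refl
length-concat-map f (x ∷ xs) =
  trans (length-++ (f x)) (cong (length (f x) +_) (length-concat-map f xs))

length-cartesianProduct : ∀ {A B : Set} (xs : List A) (ys : List B) →
                          length (cartesianProduct xs ys) ≡ length xs * length ys
length-cartesianProduct []       ys = refl
length-cartesianProduct (x ∷ xs) ys = trans (length-++ (map (x ,_) ys))
  (cong₂ _+_ (length-map (x ,_) ys) (length-cartesianProduct xs ys))

unique-map : ∀ {A B : Set} {f : A → B} {xs} →
             (∀ {x y} → x ∈ₗ xs → y ∈ₗ xs → f x ≡ f y → x ≡ y) → Unique xs → Unique (map f xs)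
unique-map {xs = []}     inj []            = []
unique-map {xs = x ∷ xs} inj (x∉xs ∷ uniq) =
  All.map⁺ (All.tabulate λ y∈xs fx≡fy →
    All.lookup x∉xs y∈xs (inj (here refl) (there y∈xs) fx≡fy))
  ∷ unique-map (λ x∈xs y∈xs → inj (there x∈xs) (there y∈xs)) uniq

elements : ∀ {n} → Subset n → List (Fin n)
elements []          = []
elements (true  ∷ p) = Fin.zero ∷ map Fin.suc (elements p)
elements (false ∷ p) = map Fin.suc (elements p)

length-elements : ∀ {n} (p : Subset n) → length (elements p) ≡ ∣ p ∣
length-elements []          = refl
length-elements (true  ∷ p) = cong suc (trans (length-map Fin.suc (elements p)) (length-elements p))
length-elements (false ∷ p) = trans (length-map Fin.suc (elements p)) (length-elements p)

∈-elements⁺ : ∀ {n x} {p : Subset n} → x ∈ p → x ∈ₗ elements p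
∈-elements⁺                 here        = here refl
∈-elements⁺ {p = true  ∷ p} (there x∈p) = there (∈-map⁺ Fin.suc (∈-elements⁺ x∈p))
∈-elements⁺ {p = false ∷ p} (there x∈p) = ∈-map⁺ Fin.suc (∈-elements⁺ x∈p)

∈-elements⁻ : ∀ {n x} (p : Subset n) → x ∈ₗ elements p → x ∈ p
∈-elements⁻ (true  ∷ p) (here refl) = here
∈-elements⁻ (true  ∷ p) (there x∈) with _ , y∈ , refl ← ∈-map⁻ Fin.suc x∈ = there (∈-elements⁻ p y∈)
∈-elements⁻ (false ∷ p) x∈         with _ , y∈ , refl ← ∈-map⁻ Fin.suc x∈ = there (∈-elements⁻ p y∈)

unique-elements : ∀ {n} (p : Subset n) → Unique (elements p)
unique-elements []          = []
unique-elements (true  ∷ p) =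
  All.map⁺ (All.tabulate λ _ ()) ∷ Unique.map⁺ (λ { refl → refl }) (unique-elements p)
unique-elements (false ∷ p) = Unique.map⁺ (λ { refl → refl }) (unique-elements p)

∣p∣≡0⇒p≡⊥ : ∀ {n} {p : Subset n} → ∣ p ∣ ≡ 0 → p ≡ ⊥
∣p∣≡0⇒p≡⊥ {p = p} ∣p∣≡0 = Empty-unique λ (_ , x∈p) → nonempty (∈-elements⁺ x∈p)
  (trans (length-elements p) ∣p∣≡0)
  where
  nonempty : ∀ {A : Set} {x : A} {xs} → x ∈ₗ xs → length xs ≢ 0
  nonempty (here _)  ()
  nonempty (there _) ()

∣⁅x⁆∪⁅y⁆∣≡2 : ∀ {n} {x y : Fin n} → x ≢ y → ∣ ⁅ x ⁆ ∪ ⁅ y ⁆ ∣ ≡ 2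
∣⁅x⁆∪⁅y⁆∣≡2 {x = Fin.zero}  {Fin.zero}  x≢y = contradiction refl x≢y
∣⁅x⁆∪⁅y⁆∣≡2 {x = Fin.zero}  {Fin.suc y} x≢y =
  cong suc (trans (cong ∣_∣ (∪-identityˡ ⁅ y ⁆)) (∣⁅x⁆∣≡1 y))
∣⁅x⁆∪⁅y⁆∣≡2 {x = Fin.suc x} {Fin.zero}  x≢y =
  cong suc (trans (cong ∣_∣ (∪-identityʳ ⁅ x ⁆)) (∣⁅x⁆∣≡1 x))
∣⁅x⁆∪⁅y⁆∣≡2 {x = Fin.suc x} {Fin.suc y} x≢y = ∣⁅x⁆∪⁅y⁆∣≡2 (x≢y ∘ cong Fin.suc)

lists-pair : ∀ {n} {x y : Fin n} → x ≢ y → Lists (x ∷ y ∷ []) (⁅ x ⁆ ∪ ⁅ y ⁆)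
lists-pair {x = x} {y} x≢y = ((x≢y ∷ []) ∷ [] ∷ []) , λ v → mk⇔
  (λ { (here refl) → x∈p∪q⁺ (inj₁ (x∈⁅x⁆ x)) ; (there (here refl)) → x∈p∪q⁺ (inj₂ (x∈⁅x⁆ y)) })
  (λ v∈ → Sum.[ (λ v∈x → here (x∈⁅y⁆⇒x≡y x v∈x)) , (λ v∈y → there (here (x∈⁅y⁆⇒x≡y y v∈y))) ]′
    (x∈p∪q⁻ ⁅ x ⁆ ⁅ y ⁆ v∈))

∈-tabulate⁺ : ∀ {n x} {f : Fin n → Bool} → f x ≡ true → x ∈ tabulate f
∈-tabulate⁺ {x = x} {f} fx = lookup⇒[]= x (tabulate f) (trans (lookup∘tabulate f x) fx)

∈-tabulate⁻ : ∀ {n x} {f : Fin n → Bool} → x ∈ tabulate f → f x ≡ true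
∈-tabulate⁻ {x = x} {f} x∈ = trans (sym (lookup∘tabulate f x)) ([]=⇒lookup x∈)

V-new⁻ : ∀ {n x} (Vₒₙ D : Subset n) → x ∈ V-new Vₒₙ D → x ∈ Vₒₙ ⊎ x ∈ D
V-new⁻ Vₒₙ D x∈ = Sum.map (p─q⊆p Vₒₙ D) (proj₂ ∘ x∈p∩q⁻ _ D) (x∈p∪q⁻ _ _ x∈)

V-new-on⁺ : ∀ {n x} {Vₒₙ D : Subset n} → x ∈ Vₒₙ → x ∉ D → x ∈ V-new Vₒₙ D
V-new-on⁺ x∈Vₒₙ x∉D = x∈p∪q⁺ (inj₁ (x∈p∧x∉q⇒x∈p─q x∈Vₒₙ x∉D))

V-new-off⁺ : ∀ {n x} {Vₒₙ D : Subset n} → x ∉ Vₒₙ → x ∈ D → x ∈ V-new Vₒₙ D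
V-new-off⁺ x∉Vₒₙ x∈D = x∈p∪q⁺ (inj₂ (x∈p∩q⁺ (x∉p⇒x∈∁p x∉Vₒₙ , x∈D)))

vertex : ∀ {n} .{{_ : NonZero n}} → ℕ → Fin n
vertex {n} x = fromℕ< (m%n<n x n)

toℕ-vertex : ∀ {n} .{{_ : NonZero n}} {x} → x < n → toℕ (vertex {n} x) ≡ x
toℕ-vertex x<n = trans (toℕ-fromℕ< _) (m<n⇒m%n≡m x<n)

OrderedBelow : ℕ → ℕ × ℕ → Set
OrderedBelow n (x , y) = x < y × y < n

module _ {n : ℕ} .{{_ : NonZero n}} (es : List (ℕ × ℕ))
         (sorted′ : All (OrderedBelow n) es) (unique′ : Unique es) where

  toEdge : ℕ × ℕ → Fin n × Fin n
  toEdge (x , y) = vertex x , vertex y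

  toℕ-toEdge : ∀ {x y} → (x , y) ∈ₗ es → toℕ (vertex {n} x) ≡ x × toℕ (vertex {n} y) ≡ y
  toℕ-toEdge xy∈ with x<y , y<n ← All.lookup sorted′ xy∈ =
    toℕ-vertex (<-trans x<y y<n) , toℕ-vertex y<n

  graph : Graph n
  graph .edges  = map toEdge es
  graph .sorted = All.map⁺ (All.tabulate λ xy∈ → let x≡ , y≡ = toℕ-toEdge xy∈ in
    subst₂ _<_ (sym x≡) (sym y≡) (proj₁ (All.lookup sorted′ xy∈)))
  graph .unique = unique-map (λ xy∈ xy′∈ eq →
    let x≡ , y≡ = toℕ-toEdge xy∈ ; x′≡ , y′≡ = toℕ-toEdge xy′∈ in
    cong₂ _,_ (trans (sym x≡) (trans (cong toℕ (,-injectiveˡ eq)) x′≡))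
              (trans (sym y≡) (trans (cong toℕ (,-injectiveʳ eq)) y′≡))) unique′

  edge⁺ : ∀ {x y} → (x , y) ∈ₗ es → (vertex x , vertex y) ∈ₗ edges graph
  edge⁺ = ∈-map⁺ toEdge

  edge⁻ : ∀ {u v} → (u , v) ∈ₗ edges graph → (toℕ u , toℕ v) ∈ₗ es
  edge⁻ uv∈ with _ , xy∈ , refl ← ∈-map⁻ toEdge uv∈ =
    let x≡ , y≡ = toℕ-toEdge xy∈ in subst₂ (λ x y → (x , y) ∈ₗ es) (sym x≡) (sym y≡) xy∈

firstIndex : ∀ {n} → Fin n → List (Fin n) → ℕ
firstIndex x []       = 0
firstIndex x (y ∷ ys) with x Fin.≟ y
... | yes _ = 0
... | no  _ = suc (firstIndex x ys)

firstIndex<length : ∀ {n} {x : Fin n} {xs} → x ∈ₗ xs → firstIndex x xs < length xs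
firstIndex<length {x = x} {y ∷ ys} x∈ with x Fin.≟ y | x∈
... | yes _  | _           = z<s
... | no x≢y | here x≡y    = contradiction x≡y x≢y
... | no _   | there x∈ys  = s<s (firstIndex<length x∈ys)

firstIndex-injective : ∀ {n} {x y : Fin n} {zs} → x ∈ₗ zs →
                       firstIndex x zs ≡ firstIndex y zs → x ≡ y
firstIndex-injective {x = x} {y} {z ∷ zs} x∈ same with x Fin.≟ z | y Fin.≟ z | x∈
... | yes x≡z | yes y≡z | _          = trans x≡z (sym y≡z)
... | no x≢z  | no _    | here x≡z   = contradiction x≡z x≢z
... | no _    | no _    | there x∈zs = firstIndex-injective x∈zs (suc-injective same)

module _ (F : Family) where

  sizes : List (Fin (count F)) → ℕ
  sizes is = sum (map (λ i → ∣ sets F i ∣) is)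

  length≤sizes : ∀ {is} → All (λ i → ∣ sets F i ∣ ≢ 0) is → length is ≤ sizes is
  length≤sizes []         = z≤n
  length≤sizes (i≢0 ∷ is) = +-mono-≤ (n≢0⇒n>0 i≢0) (length≤sizes is)

  -- Only one of the distinct sets can be empty.
  length≤1+sizes : ∀ {is} → Unique is → length is ≤ suc (sizes is)
  length≤1+sizes []                                  = z≤n
  length≤1+sizes {i ∷ is} (i∉is ∷ uniq) with ∣ sets F i ∣ in ∣i∣≡
  ... | zero  = s≤s (length≤sizes (All.map (λ i≢j ∣j∣≡0 → i≢j (distinct F
                  (trans (∣p∣≡0⇒p≡⊥ ∣i∣≡) (sym (∣p∣≡0⇒p≡⊥ ∣j∣≡0))))) i∉is))
  ... | suc s = s≤s (≤-trans (length≤1+sizes uniq) (s≤s (m≤n+m (sizes is) s)))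

  count≤1+total : count F ≤ suc (total F)
  count≤1+total = subst (_≤ suc (total F)) (length-tabulate {n = count F} (λ i → i))
                    (length≤1+sizes (Unique.allFin⁺ (count F)))

  Incidence : Set
  Incidence = Fin (count F) × Fin (universe F)

  row : Fin (count F) → List Incidence
  row i = map (i ,_) (elements (sets F i))

  incidences : List Incidence
  incidences = concat (map row (allFin (count F)))

  length-incidences : length incidences ≡ total F
  length-incidences = trans (length-concat-map row (allFin (count F)))
    (cong sum (map-cong
      (λ i → trans (length-map (i ,_) (elements (sets F i))) (length-elements (sets F i)))
      (allFin (count F))))

  ∈-incidences⁺ : ∀ {i e} → e ∈ sets F i → (i , e) ∈ₗ incidences
  ∈-incidences⁺ {i} e∈ = ∈-concat⁺′ (∈-map⁺ (i ,_) (∈-elements⁺ e∈)) (∈-map⁺ row (∈-allFin i))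

  ∈-incidences⁻ : ∀ {i e} → (i , e) ∈ₗ incidences → e ∈ sets F i
  ∈-incidences⁻ ie∈ with ∈-concat⁻′ (map row (allFin (count F))) ie∈
  ... | _ , ie∈row , row∈ with ∈-map⁻ row row∈
  ... | i , _ , refl with ∈-map⁻ (i ,_) ie∈row
  ... | _ , e∈ , refl = ∈-elements⁻ (sets F i) e∈

  unique-incidences : Unique incidences
  unique-incidences = Unique.concat⁺
    (All.map⁺ (All.universal (λ i → Unique.map⁺ (λ { refl → refl }) (unique-elements (sets F i))) _))
    (AllPairs.map⁺ (AllPairs.map rows-disjoint (Unique.allFin⁺ (count F))))
    where
    rows-disjoint : ∀ {i j} → i ≢ j → ∀ {x} → ¬ (x ∈ₗ row i × x ∈ₗ row j)
    rows-disjoint {i} {j} i≢j (x∈i , x∈j)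
      with _ , _ , refl ← ∈-map⁻ (i ,_) x∈i | _ , _ , refl ← ∈-map⁻ (j ,_) x∈j = i≢j refl

  usedElements : List (Fin (universe F))
  usedElements = map proj₂ incidences

  ∈-usedElements : ∀ {i e} → e ∈ sets F i → e ∈ₗ usedElements
  ∈-usedElements e∈ = ∈-map⁺ proj₂ (∈-incidences⁺ e∈)

-- The vertices 2i and 2i + 1 are two copies of the i-th set, so that queries
-- with i = j need no special treatment; they are followed by the vertices of
-- the elements that occur in some set (only these are active before the update)
-- and by 2q padding vertices, which carry the edges missing from the required m.
module Reduction (F : Family) {n q m : ℕ} (n≡ : n ≡ 3 * suc (total F) + (q + q))
                 (2N≤m : 2 * total F ≤ m) (m≤2N+q² : m ≤ 2 * total F + q * q) where

  N elementStart paddingStart : ℕ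
  N            = total F
  elementStart = 2 * suc N
  paddingStart = 3 * suc N

  copyVertex : Bool → Fin (count F) → ℕ
  copyVertex b i = fromBool b + 2 * toℕ i

  elementVertex : Fin (universe F) → ℕ
  elementVertex e = elementStart + firstIndex e (usedElements F)

  copyVertex-injective : ∀ {b b′ i i′} → copyVertex b i ≡ copyVertex b′ i′ → b ≡ b′ × i ≡ i′
  copyVertex-injective {false} {false} same = refl , toℕ-injective (*-cancelˡ-≡ _ _ 2 same)
  copyVertex-injective {false} {true}  {i} {i′} same = contradiction same (even≢odd (toℕ i) (toℕ i′))
  copyVertex-injective {true}  {false} {i} {i′} same = contradiction (sym same) (even≢odd (toℕ i′) (toℕ i))
  copyVertex-injective {true}  {true}  same =
    refl , toℕ-injective (*-cancelˡ-≡ _ _ 2 (suc-injective same))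

  copyVertex<elementStart : ∀ b i → copyVertex b i < elementStart
  copyVertex<elementStart b i = begin-strict
    fromBool b + 2 * toℕ i  <⟨ +-monoˡ-< (2 * toℕ i) (fromBool<2 b) ⟩
    2 + 2 * toℕ i           ≡⟨ *-suc 2 (toℕ i) ⟨
    2 * suc (toℕ i)         ≤⟨ *-monoʳ-≤ 2 (≤-trans (toℕ<n i) (count≤1+total F)) ⟩
    elementStart            ∎
    where
    open ≤-Reasoning
    fromBool<2 : ∀ b → fromBool b < 2
    fromBool<2 true  = s<s z<s
    fromBool<2 false = z<s

  elementStart≤elementVertex : ∀ e → elementStart ≤ elementVertex e
  elementStart≤elementVertex e = m≤m+n elementStart _

  copyVertex<elementVertex : ∀ b i e → copyVertex b i < elementVertex e
  copyVertex<elementVertex b i e =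
    <-≤-trans (copyVertex<elementStart b i) (elementStart≤elementVertex e)

  elementVertex<paddingStart : ∀ {i e} → e ∈ sets F i → elementVertex e < paddingStart
  elementVertex<paddingStart {i} {e} e∈i = begin-strict
    elementStart + firstIndex e (usedElements F)  <⟨ +-monoʳ-< elementStart
                                                        (firstIndex<length (∈-usedElements F e∈i)) ⟩
    elementStart + length (usedElements F)        ≡⟨ cong (elementStart +_)
                                                        (trans (length-map proj₂ (incidences F))
                                                               (length-incidences F)) ⟩
    elementStart + N                              ≤⟨ +-monoʳ-≤ elementStart (n≤1+n N) ⟩
    elementStart + suc N                          ≡⟨ +-comm elementStart (suc N) ⟩
    paddingStart                                  ∎
    where open ≤-Reasoning

  elementVertex-injective : ∀ {i e e′} → e ∈ sets F i → elementVertex e ≡ elementVertex e′ → e ≡ e′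
  elementVertex-injective e∈i same =
    firstIndex-injective (∈-usedElements F e∈i) (+-cancelˡ-≡ elementStart _ _ same)

  paddingStart+2q : paddingStart + q + q ≡ n
  paddingStart+2q = trans (+-assoc paddingStart q q) (sym n≡)

  paddingStart≤n : paddingStart ≤ n
  paddingStart≤n = subst (paddingStart ≤_) (sym n≡) (m≤m+n paddingStart (q + q))

  instance
    n≢0 : NonZero n
    n≢0 = >-nonZero (≤-trans z<s paddingStart≤n)

  data Edge : ℕ × ℕ → Set where
    incidence : ∀ {b i e} → e ∈ sets F i → Edge (copyVertex b i , elementVertex e)
    padding   : ∀ {x y} → paddingStart ≤ x → x < y → y < n → Edge (x , y)

  Edge⇒OrderedBelow : ∀ {xy} → Edge xy → OrderedBelow n xy
  Edge⇒OrderedBelow (incidence {b} {i} {e} e∈i) =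
    copyVertex<elementVertex b i e , <-≤-trans (elementVertex<paddingStart e∈i) paddingStart≤n
  Edge⇒OrderedBelow (padding _ x<y y<n) = x<y , y<n

  incidenceEdge : Bool → Incidence F → ℕ × ℕ
  incidenceEdge b (i , e) = copyVertex b i , elementVertex e

  incidenceEdges : Bool → List (ℕ × ℕ)
  incidenceEdges b = map (incidenceEdge b) (incidences F)

  paddingEdges : List (ℕ × ℕ)
  paddingEdges = cartesianProduct (applyUpTo (paddingStart +_) q) (applyUpTo (paddingStart + q +_) q)

  allEdges : List (ℕ × ℕ)
  allEdges = incidenceEdges false ++ incidenceEdges true ++ take (m ∸ 2 * N) paddingEdges

  incidenceEdges-Edge : ∀ b → All Edge (incidenceEdges b)
  incidenceEdges-Edge b = All.map⁺ (All.tabulate λ ie∈ → incidence {b} (∈-incidences⁻ F ie∈))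

  paddingEdges-≥ : All (λ (x , y) → paddingStart ≤ x × x < y × y < n) paddingEdges
  paddingEdges-≥ = All.tabulate λ xy∈ → bounds xy∈
    where
    bounds : ∀ {x y} → (x , y) ∈ₗ paddingEdges → paddingStart ≤ x × x < y × y < n
    bounds xy∈ with x∈ , y∈ ← ∈-cartesianProduct⁻ (applyUpTo (paddingStart +_) q) _ xy∈
      with a , a<q , refl ← ∈-applyUpTo⁻ (paddingStart +_) x∈
         | b , b<q , refl ← ∈-applyUpTo⁻ (paddingStart + q +_) y∈ =
      m≤m+n paddingStart a ,
      <-≤-trans (+-monoʳ-< paddingStart a<q) (m≤m+n (paddingStart + q) b) ,
      subst (paddingStart + q + b <_) paddingStart+2q (+-monoʳ-< (paddingStart + q) b<q)

  allEdges-Edge : All Edge allEdges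
  allEdges-Edge = All.++⁺ (incidenceEdges-Edge false) (All.++⁺ (incidenceEdges-Edge true)
    (All.take⁺ (m ∸ 2 * N) (All.map (λ (P≤x , x<y , y<n) → padding P≤x x<y y<n) paddingEdges-≥)))

  unique-incidenceEdges : ∀ b → Unique (incidenceEdges b)
  unique-incidenceEdges b = 
    unique-map (λ {x} {y} x∈ _ same → injective {x} {y} x∈ same) (unique-incidences F)
    where
    injective : ∀ {x y} → x ∈ₗ incidences F → incidenceEdge b x ≡ incidenceEdge b y → x ≡ y
    injective x∈ same = cong₂ _,_ (proj₂ (copyVertex-injective {b} {b} (,-injectiveˡ same)))
      (elementVertex-injective (∈-incidences⁻ F x∈) (,-injectiveʳ same))

  unique-paddingEdges : Unique paddingEdges
  unique-paddingEdges =
    Unique.cartesianProduct⁺ (unique-range paddingStart) (unique-range (paddingStart + q))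
    where
    unique-range : ∀ s → Unique (applyUpTo (s +_) q)
    unique-range s = Unique.applyUpTo⁺₁ (s +_) q λ i<j _ same → <⇒≢ i<j (+-cancelˡ-≡ s _ _ same)

  unique-allEdges : Unique allEdges
  unique-allEdges = Unique.++⁺ (unique-incidenceEdges false)
    (Unique.++⁺ (unique-incidenceEdges true) (Unique.take⁺ (m ∸ 2 * N) unique-paddingEdges)
      (λ (x∈ , x∈′) → incidence≢padding {true} x∈ x∈′))
    λ (x∈ , x∈′) → Sum.[ copies-disjoint x∈ , incidence≢padding {false} x∈ ]′
      (∈-++⁻ (incidenceEdges true) x∈′)
    where
    copies-disjoint : ∀ {x} → x ∈ₗ incidenceEdges false → ¬ (x ∈ₗ incidenceEdges true)
    copies-disjoint x∈ x∈′
      with (i , _) , _ , refl ← ∈-map⁻ (incidenceEdge false) x∈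
      with (i′ , _) , _ , same ← ∈-map⁻ (incidenceEdge true) x∈′
      = even≢odd (toℕ i) (toℕ i′) (,-injectiveˡ same)
    incidence≢padding : ∀ {b x} → x ∈ₗ incidenceEdges b → ¬ (x ∈ₗ take (m ∸ 2 * N) paddingEdges)
    incidence≢padding {b} x∈ x∈′ with (i , e) , ie∈ , refl ← ∈-map⁻ (incidenceEdge b) x∈ =
      <⇒≱ (<-trans (copyVertex<elementVertex b i e) (elementVertex<paddingStart (∈-incidences⁻ F ie∈)))
          (proj₁ (All.lookup (All.take⁺ (m ∸ 2 * N) paddingEdges-≥) x∈′))

  length-allEdges : length allEdges ≡ m
  length-allEdges = begin
    length allEdges              ≡⟨ length-++ (incidenceEdges false) ⟩
    length (incidenceEdges false) + length (incidenceEdges true ++ rest)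
                                 ≡⟨ cong₂ _+_ (length-incidenceEdges false)
                                                (length-++ (incidenceEdges true)) ⟩
    N + (length (incidenceEdges true) + length rest)
                                 ≡⟨ cong₂ (λ x y → N + (x + y))
                                      (length-incidenceEdges true) length-rest ⟩
    N + (N + (m ∸ 2 * N))        ≡⟨ +-assoc N N _ ⟨
    N + N + (m ∸ 2 * N)          ≡⟨ cong (λ x → N + x + (m ∸ 2 * N)) (+-identityʳ N) ⟨
    2 * N + (m ∸ 2 * N)          ≡⟨ m+[n∸m]≡n 2N≤m ⟩
    m                            ∎
    where
    open ≡-Reasoning
    rest = take (m ∸ 2 * N) paddingEdges
    length-incidenceEdges : ∀ b → length (incidenceEdges b) ≡ N
    length-incidenceEdges b = trans (length-map (incidenceEdge b) (incidences F)) (length-incidences F)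
    length-paddingEdges : length paddingEdges ≡ q * q
    length-paddingEdges = trans (length-cartesianProduct (applyUpTo (paddingStart +_) q) _)
      (cong₂ _*_ (length-applyUpTo (paddingStart +_) q) (length-applyUpTo (paddingStart + q +_) q))
    length-rest : length rest ≡ m ∸ 2 * N
    length-rest = trans (length-take (m ∸ 2 * N) paddingEdges)
      (m≤n⇒m⊓n≡m (subst (m ∸ 2 * N ≤_) (sym length-paddingEdges) (m≤n+o⇒m∸n≤o m (2 * N) m≤2N+q²)))

  orderedBelow-allEdges : All (OrderedBelow n) allEdges
  orderedBelow-allEdges = All.map Edge⇒OrderedBelow allEdges-Edge

  G : Graph n
  G = graph allEdges orderedBelow-allEdges unique-allEdges

  length-G : length (edges G) ≡ m
  length-G = trans (length-map _ allEdges) length-allEdges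

  IsElementVertex : ℕ → Set
  IsElementVertex x = elementStart ≤ x × x < paddingStart

  isElementVertex? : ∀ x → Dec (IsElementVertex x)
  isElementVertex? x = elementStart ≤? x ×-dec x <? paddingStart

  Vₒₙ : Subset n
  Vₒₙ = tabulate λ v → ⌊ isElementVertex? (toℕ v) ⌋

  Vₒₙ⁺ : ∀ {v} → IsElementVertex (toℕ v) → v ∈ Vₒₙ
  Vₒₙ⁺ = ∈-tabulate⁺ ∘ Equivalence.to T-≡ ∘ fromWitness

  Vₒₙ⁻ : ∀ {v} → v ∈ Vₒₙ → IsElementVertex (toℕ v)
  Vₒₙ⁻ = toWitness ∘ Equivalence.from T-≡ ∘ ∈-tabulate⁻

  toℕ-copyVertex : ∀ b i → toℕ (vertex {n} (copyVertex b i)) ≡ copyVertex b i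
  toℕ-copyVertex b i = toℕ-vertex (<-≤-trans (copyVertex<elementStart b i)
    (≤-trans (*-monoˡ-≤ (suc N) (n≤1+n 2)) paddingStart≤n))

  copyVertex∉Vₒₙ : ∀ b i → vertex (copyVertex b i) ∉ Vₒₙ
  copyVertex∉Vₒₙ b i ∈Vₒₙ = <⇒≱ (copyVertex<elementStart b i)
    (subst (elementStart ≤_) (toℕ-copyVertex b i) (proj₁ (Vₒₙ⁻ ∈Vₒₙ)))

  incidence∈G : ∀ b {i e} → e ∈ sets F i →
                (vertex (copyVertex b i) , vertex (elementVertex e)) ∈ₗ edges G
  incidence∈G b {i} {e} e∈i = edge⁺ allEdges orderedBelow-allEdges unique-allEdges (∈allEdges b)
    where
    ∈allEdges : ∀ b → (copyVertex b i , elementVertex e) ∈ₗ allEdges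
    ∈allEdges false = ∈-++⁺ˡ (∈-map⁺ (incidenceEdge false) (∈-incidences⁺ F e∈i))
    ∈allEdges true  = ∈-++⁺ʳ (incidenceEdges false)
      (∈-++⁺ˡ (∈-map⁺ (incidenceEdge true) (∈-incidences⁺ F e∈i)))

  adjacent⁻ : ∀ {x y} → Adjacent G x y → Edge (toℕ x , toℕ y) ⊎ Edge (toℕ y , toℕ x)
  adjacent⁻ = Sum.map edge edge
    where
    edge : ∀ {x y} → (x , y) ∈ₗ edges G → Edge (toℕ x , toℕ y)
    edge xy∈ = All.lookup allEdges-Edge (edge⁻ allEdges orderedBelow-allEdges unique-allEdges xy∈)

  module _ (i j : Fin (count F)) where

    u v : Fin n
    u = vertex (copyVertex false i)
    v = vertex (copyVertex true j)

    D : Subset n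
    D = ⁅ u ⁆ ∪ ⁅ v ⁆

    u≢v : u ≢ v
    u≢v u≡v with () ← proj₁ (copyVertex-injective {false} {true} {i} {j}
      (trans (sym (toℕ-copyVertex false i)) (trans (cong toℕ u≡v) (toℕ-copyVertex true j))))

    u∈V-new : u ∈ V-new Vₒₙ D
    u∈V-new = V-new-off⁺ (copyVertex∉Vₒₙ false i) (x∈p∪q⁺ (inj₁ (x∈⁅x⁆ u)))

    v∈V-new : v ∈ V-new Vₒₙ D
    v∈V-new = V-new-off⁺ (copyVertex∉Vₒₙ true j) (x∈p∪q⁺ (inj₂ (x∈⁅x⁆ v)))

    IsActive : ℕ → Set
    IsActive x = IsElementVertex x ⊎ x ≡ copyVertex false i ⊎ x ≡ copyVertex true j

    V-new⇒IsActive : ∀ {x} → x ∈ V-new Vₒₙ D → IsActive (toℕ x)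
    V-new⇒IsActive x∈ with V-new⁻ Vₒₙ D x∈
    ... | inj₁ x∈Vₒₙ = inj₁ (Vₒₙ⁻ x∈Vₒₙ)
    ... | inj₂ x∈D with x∈p∪q⁻ ⁅ u ⁆ ⁅ v ⁆ x∈D
    ...   | inj₁ x∈u = inj₂ (inj₁ (trans (cong toℕ (x∈⁅y⁆⇒x≡y u x∈u)) (toℕ-copyVertex false i)))
    ...   | inj₂ x∈v = inj₂ (inj₂ (trans (cong toℕ (x∈⁅y⁆⇒x≡y v x∈v)) (toℕ-copyVertex true j)))

    IsActive⇒<paddingStart : ∀ {x} → IsActive x → x < paddingStart
    IsActive⇒<paddingStart (inj₁ (_ , x<P))   = x<P
    IsActive⇒<paddingStart (inj₂ (inj₁ refl)) =
      <-≤-trans (copyVertex<elementStart false i) (*-monoˡ-≤ (suc N) (n≤1+n 2))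
    IsActive⇒<paddingStart (inj₂ (inj₂ refl)) =
      <-≤-trans (copyVertex<elementStart true j) (*-monoˡ-≤ (suc N) (n≤1+n 2))

    common-element⇒connected : ∀ {e} → e ∈ sets F i ∩ sets F j → ConnectedIn G (V-new Vₒₙ D) u v
    common-element⇒connected {e} e∈ with e∈i , e∈j ← x∈p∩q⁻ (sets F i) (sets F j) e∈ =
      (inj₁ (incidence∈G false e∈i) , u∈V-new , x∈V-new) ◅
      (inj₂ (incidence∈G true e∈j) , x∈V-new , v∈V-new) ◅ ε
      where
      x = vertex {n} (elementVertex e)
      x∈Vₒₙ : x ∈ Vₒₙ
      x∈Vₒₙ = let x<P = elementVertex<paddingStart (proj₁ (x∈p∩q⁻ (sets F i) (sets F j) e∈)) in
        Vₒₙ⁺ (subst IsElementVertex (sym (toℕ-vertex (<-≤-trans x<P paddingStart≤n)))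
          (elementStart≤elementVertex e , x<P))
      x∉D : x ∉ D
      x∉D x∈D with x∈p∪q⁻ ⁅ u ⁆ ⁅ v ⁆ x∈D
      ... | inj₁ x∈u = copyVertex∉Vₒₙ false i (subst (_∈ Vₒₙ) (x∈⁅y⁆⇒x≡y u x∈u) x∈Vₒₙ)
      ... | inj₂ x∈v = copyVertex∉Vₒₙ true j (subst (_∈ Vₒₙ) (x∈⁅y⁆⇒x≡y v x∈v) x∈Vₒₙ)
      x∈V-new : x ∈ V-new Vₒₙ D
      x∈V-new = V-new-on⁺ x∈Vₒₙ x∉D

    Reached : ℕ → Set
    Reached x = x ≡ copyVertex false i ⊎ ∃[ e ] e ∈ sets F i × x ≡ elementVertex e

    reached-step : Empty (sets F i ∩ sets F j) → ∀ {x y} → Edge (x , y) ⊎ Edge (y , x) →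
                   IsActive x → IsActive y → Reached x → Reached y
    reached-step disjoint (inj₁ (padding P≤x _ _)) x-on _ _ =
      contradiction P≤x (<⇒≱ (IsActive⇒<paddingStart x-on))
    reached-step disjoint (inj₂ (padding P≤y _ _)) _ y-on _ =
      contradiction P≤y (<⇒≱ (IsActive⇒<paddingStart y-on))
    reached-step disjoint (inj₁ (incidence {b} {k} e∈k)) _ _ (inj₁ k≡i) =
      inj₂ (_ , subst (λ k → _ ∈ sets F k) (proj₂ (copyVertex-injective {b} {false} k≡i)) e∈k , refl)
    reached-step disjoint (inj₁ (incidence {b} {k} _)) _ _ (inj₂ (e′ , _ , k≡e′)) =
      contradiction k≡e′ (<⇒≢ (copyVertex<elementVertex b k e′))
    reached-step disjoint (inj₂ (incidence {e = e} _)) _ _ (inj₁ e≡i) =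
      contradiction (sym e≡i) (<⇒≢ (copyVertex<elementVertex false i e))
    reached-step disjoint (inj₂ (incidence {b} {k} e∈k)) _ (inj₁ (E≤k , _)) _ =
      contradiction E≤k (<⇒≱ (copyVertex<elementStart b k))
    reached-step disjoint (inj₂ (incidence e∈k)) _ (inj₂ (inj₁ k≡i)) _ = inj₁ k≡i
    reached-step disjoint (inj₂ (incidence {b} e∈k)) _ (inj₂ (inj₂ k≡j)) (inj₂ (e′ , e′∈i , e≡e′)) =
      contradiction (_ , x∈p∩q⁺ (e′∈i , subst₂ (λ e k → e ∈ sets F k)
        (elementVertex-injective e∈k e≡e′) (proj₂ (copyVertex-injective {b} {true} k≡j)) e∈k)) disjoint

    reached-path : Empty (sets F i ∩ sets F j) → ∀ {x y} → ConnectedIn G (V-new Vₒₙ D) x y →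
                   Reached (toℕ x) → Reached (toℕ y)
    reached-path disjoint ε                              x-reached = x-reached
    reached-path disjoint ((adjacent , x∈ , y∈) ◅ path) x-reached =
      reached-path disjoint path (reached-step disjoint (adjacent⁻ adjacent)
        (V-new⇒IsActive x∈) (V-new⇒IsActive y∈) x-reached)

    connected⇒¬empty : ConnectedIn G (V-new Vₒₙ D) u v → ¬ Empty (sets F i ∩ sets F j)
    connected⇒¬empty path disjoint with reached-path disjoint path (inj₁ (toℕ-copyVertex false i))
    ... | inj₁ v≡u with () ← proj₁ (copyVertex-injective {true} {false} {j} {i}
                               (trans (sym (toℕ-copyVertex true j)) v≡u))
    ... | inj₂ (e , _ , v≡e) = <⇒≢ (copyVertex<elementVertex true j e)
                                 (trans (sym (toℕ-copyVertex true j)) v≡e)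

-- From oracles to disjointness structures

linearΘ⇒sizes : ∀ {μ} → LinearΘ μ → ∃[ q ] ∀ N → let n = (3 + (q + q)) * suc N in
                2 * N ≤ μ n × μ n ≤ (q * suc N) * (q * suc N)
linearΘ⇒sizes {μ} (a , b , N₀ , bounds) = q , λ N → lower N , upper N
  where
  open ≤-Reasoning
  q = suc (5 * b + a + N₀)
  c = 3 + (q + q)
  5b≤q : 5 * b ≤ q
  5b≤q = ≤-trans (m≤m+n (5 * b) a) (≤-trans (m≤m+n _ N₀) (n≤1+n _))
  a≤q : a ≤ q
  a≤q = ≤-trans (m≤n+m a (5 * b)) (≤-trans (m≤m+n _ N₀) (n≤1+n _))
  N₀≤n : ∀ N → N₀ ≤ c * suc N
  N₀≤n N = begin
    N₀         ≤⟨ ≤-trans (m≤n+m N₀ (5 * b + a)) (n≤1+n _) ⟩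
    q          ≤⟨ m≤n+m q (3 + q) ⟩
    c          ≤⟨ m≤m*n c (suc N) ⟩
    c * suc N  ∎
  lower : ∀ N → 2 * N ≤ μ (c * suc N)
  lower N = ≮⇒≥ λ μ<2N → n≮n (c * suc N) (begin-strict
    c * suc N          ≤⟨ proj₁ (bounds (c * suc N) (N₀≤n N)) ⟩
    a * μ (c * suc N)  ≤⟨ *-mono-≤ a≤q (<⇒≤ μ<2N) ⟩
    q * (2 * N)        ≡⟨ regroup q N ⟩
    (q + q) * N        ≤⟨ *-monoˡ-≤ N (m≤n+m (q + q) 3) ⟩
    c * N              <⟨ *-monoʳ-< c (n<1+n N) ⟩
    c * suc N          ∎)
    where
    regroup : ∀ q N → q * (2 * N) ≡ (q + q) * N
    regroup = solve-∀
  upper : ∀ N → μ (c * suc N) ≤ (q * suc N) * (q * suc N)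
  upper N = begin
    μ (c * suc N)              ≤⟨ proj₂ (bounds (c * suc N) (N₀≤n N)) ⟩
    b * (c * suc N)            ≤⟨ *-monoʳ-≤ b (*-monoˡ-≤ (suc N) (+-monoˡ-≤ (q + q)
                                    (*-monoʳ-≤ 3 (z<s {n = 5 * b + a + N₀})))) ⟩
    b * ((3 * q + (q + q)) * suc N) ≡⟨ regroup b q (suc N) ⟩
    5 * b * (q * suc N)        ≤⟨ *-monoˡ-≤ (q * suc N) (≤-trans 5b≤q (m≤m*n q (suc N))) ⟩
    q * suc N * (q * suc N)    ∎
    where
    regroup : ∀ b q N → b * ((3 * q + (q + q)) * N) ≡ 5 * b * (q * N)
    regroup = solve-∀

disjointnessStructure :
  ∀ {μ τ s T} q → let c = 3 + (q + q) in
  (∀ N → 2 * N ≤ μ (c * suc N) × μ (c * suc N) ≤ (q * suc N) * (q * suc N)) →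
  (∀ N → 2 * τ 2 (c * suc N) + 13 ≤ T N) →
  ConnectivityOracle μ τ s → DisjointnessStructure T (λ N → s (c * suc N))
disjointnessStructure {μ} {τ} {s} {T} q sizes τ≤T oracle = record
  { w          = λ N → O.w (c * suc N)
  ; wordLength = wordLength-rescale c O.wordLength
  ; preprocess = λ F → let open R F in O.preprocess 2 G length-G Vₒₙ
  ; query      = disjointnessProgram O.update O.query
  ; space      = λ F → let open R F in O.space 2 G length-G Vₒₙ
  ; correct    = correct
  }
  where
  module O = ConnectivityOracle oracle
  c = 3 + (q + q)
  size≡ : ∀ N → c * suc N ≡ 3 * suc N + (q * suc N + q * suc N)
  size≡ N = trans (*-distribʳ-+ (suc N) 3 (q + q)) (cong (3 * suc N +_) (*-distribʳ-+ (suc N) q q))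
  module R (F : Family) = Reduction F {q = q * suc (total F)}
                            (size≡ (total F)) (proj₁ (sizes (total F)))
                            (≤-trans (proj₂ (sizes (total F))) (m≤n+m _ (2 * total F)))
  correct : ∀ F (i j : Fin (count F)) →
    Within (T (total F)) (disjointnessProgram O.update O.query)
      (withQuery (toℕ i) (toℕ j)
        (initial (O.preprocess 2 (R.G F) (R.length-G F) (R.Vₒₙ F)) zeros))
      (Decides (Empty (sets F i ∩ sets F j)))
  correct F i j =
    let t , σ , run , t≤ , decides = disjointnessProgram-correct
          (≤-trans (s≤s z≤n) (proj₁ O.wordLength (c * suc (total F))))
          (connected⇒¬empty i j)
          (λ ¬connected (e , e∈) → ¬connected (common-element⇒connected i j e∈))
          (subst₂ (λ x y → Within t₀ O.update
                      (initial preprocessed (fill (wrap x ∷ wrap y ∷ [])) [ 0 ≔ wrap 2 ])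
                      (λ σ → Within t₀ O.query (withQuery x y σ) (Decides Connected)))
                    (toℕ-copyVertex false i) (toℕ-copyVertex true j) answered)
    in t , σ , run , ≤-trans t≤ (τ≤T (total F)) , decides
    where
    open R F
    t₀ = τ 2 (c * suc (total F))
    preprocessed = O.preprocess 2 G length-G Vₒₙ
    Connected = ConnectedIn G (V-new Vₒₙ (D i j)) (u i j) (v i j)
    answered : Within t₀ O.update
      (initial preprocessed (fill (wrap (toℕ (u i j)) ∷ wrap (toℕ (v i j)) ∷ [])) [ 0 ≔ wrap 2 ])
      (λ σ → Within t₀ O.query (withQuery (toℕ (u i j)) (toℕ (v i j)) σ) (Decides Connected))
    answered =
      let t , σ , run , t≤ , queries = O.correct 2 G length-G Vₒₙ (D i j)
            (∣⁅x⁆∪⁅y⁆∣≡2 (u≢v i j)) (u i j ∷ v i j ∷ []) (lists-pair (u≢v i j))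
      in t , σ , run , t≤ , queries (u i j) (v i j) (u∈V-new i j) (v∈V-new i j)

positive⇒1≤∣↥∣ : ∀ (ε : ℚ) → Positive ε → 1 ≤ abs (↥ ε)
positive⇒1≤∣↥∣ (mkℚ +[1+ n ] _ _) _ = s≤s z≤n

lemma7p10 : ∀ (μ : ℕ → ℕ) → LinearΘ μ →
    ∀ (f g : ℕ → ℕ) → Subpolynomial g →
    ∃[ T₀ ] Subpolynomial T₀ ×
    (∀ (T : ℕ → ℕ) → Subpolynomial T → (∀ N → T₀ N ≤ T N) →
    StrongSetDisjointness T →
    ∀ (ε : ℚ) → Positive ε →
    ∀ (s : ℕ → ℕ) → O[n^2- ε ] s →
    ¬ ConnectivityOracle μ (λ d n → f d * g n) s)
lemma7p10 μ μ-linear f g g-sub with q , sizes ← linearΘ⇒sizes μ-linear =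
  (λ N → 2 * f 2 * g (c * suc N) + 13) , subpolynomial-rescale (2 * f 2) 13 c g-sub ,
  λ T T-sub T₀≤T conjecture ε ε>0 s s-small oracle →
    space-bounds-incompatible c {s = s} {q = ↧ₙ ε} (positive⇒1≤∣↥∣ ε ε>0) z<s T-sub
      (conjecture (λ N → s (c * suc N)) (disjointnessStructure q sizes
        (λ N → subst (λ t → t + 13 ≤ T N) (*-assoc 2 (f 2) (g (c * suc N))) (T₀≤T N)) oracle))
      s-small
  where c = 3 + (q + q)
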